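{- Let $L_3(x,y,z,w) = 3x+y-2z-2w$. Then, as $N\to\infty$, \[ r_{L_3}(N) \geq N^{\alpha-o(1)}, \qquad \text{where } \alpha = \frac{\log 15}{3\log 5} > 0.5608687, \] i.e. for every $\delta>0$ there is $N_0$ such that $r_{L_3}(N)\ge N^{\alpha-\delta}$ for all integers $N\ge N_0$.
   Context: Let $L(x_1,\dots,x_s)=c_1x_1+\dots+c_sx_s$ with $c_i\in\mathbb{Z}\setminus\{0\}$ and $c_1+\dots+c_s=0$. For a solution $(x_1,\dots,x_s)\in\mathbb{Z}^s$ to $L=0$, let $\mathcal T$ be the partition of $[s]=\{1,\dots,s\}$ in which $i,j$ lie in the same block if and only if $x_i=x_j$. The solution is called trivial if $\sum_{i\in T}c_i=0$ for all $T\in\mathcal T$, and nontrivial otherwise. A set $A\subseteq\mathbb{Z}$ is $L$-free if all solutions $(x_1,\dots,x_s)\in A^s$ to $L=0$ are trivial. Define $r_L(N)=\max\{|A| : A\subseteq\{1,\dots,N\} \text{ is } L\text{ -free}\}$. -}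

module Defs where

open import Algebra.Bundles using (CommutativeRing)
open import Data.Bool.Base using (if_then_else_)
open import Data.Empty using (⊥; ⊥-elim)
open import Data.Fin.Base using (Fin; zero; suc; toℕ)
import Data.Fin.Properties as Fin
open import Data.Fin.Subset as Subset using (Subset; inside; outside)
import Data.Fin.Subset.Properties as Subset
open import Data.Integer.Base as ℤ using (ℤ; +_; -[1+_]; 0ℤ)
import Data.Integer.Properties as ℤ
open import Data.Integer.Solver using () renaming (module +-*-Solver to ℤ-Solver)
open import Data.List.Base as List using (List; filter; _++_)
open import Data.List.Extrema.Nat using (max; argmax-sel; xs≤max)
import Data.List.Membership.Propositional as List
open import Data.List.Membership.Propositional.Properties using (∈-map⁺; ∈-map⁻; ∈-++⁺ˡ; ∈-++⁺ʳ; ∈-filter⁺; ∈-filter⁻)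
import Data.List.Relation.Unary.All as ListAll
open import Data.List.Relation.Unary.Any using (here)
open import Data.Nat.Base as ℕ using (ℕ; zero; suc)
import Data.Nat.Properties as ℕ
open import Data.Product.Base using (∃; ∃₂; _×_; _,_; proj₁; proj₂)
open import Data.Rational.Base
open import Data.Rational.Literals using (fromℤ)
open import Data.Rational.Properties
open import Data.Rational.Solver using (module +-*-Solver)
open import Data.Rational.Unnormalised.Base as ℚᵘ using (mkℚᵘ)
import Data.Rational.Unnormalised.Properties as ℚᵘ
open import Data.Sum.Base using (_⊎_; inj₁; inj₂; [_,_]′)
open import Data.Vec.Base using (Vec; []; _∷_; lookup; tabulate)
open import Data.Vec.Relation.Unary.All using (All; []; _∷_)
open import Function.Base using (id)
open import Level using (0ℓ)
open import Relation.Binary.PropositionalEquality using (_≡_; _≢_; refl; sym; trans; cong; cong₂; subst; subst₂)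
open import Relation.Nullary using (¬_; Dec; yes; no; does)
open import Relation.Nullary.Decidable using (map′; _→-dec_; from-yes; from-no)
open import Relation.Unary using (Pred)
open import Algebra.Properties.CommutativeMonoid.Sum ℤ.+-0-commutativeMonoid using (sum)
open import Algebra.Properties.CommutativeSemiring.Exp (CommutativeRing.commutativeSemiring +-*-commutativeRing) using (_^_; ^-assocʳ; ^-distrib-*)

fromℕ : ℕ → ℚ
fromℕ n = fromℤ (+ n)

infixr 8 _^ᶻ_

_^ᶻ_ : (b : ℕ) .{{_ : ℕ.NonZero b}} → ℤ → ℚ
b ^ᶻ (+ n)    = fromℕ b ^ n
b ^ᶻ -[1+ n ] = (+ 1 / b) ^ suc n

module ℚ-Lemmas where

  *-pos : ∀ {p q} → 0ℚ < p → 0ℚ < q → 0ℚ < p * q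
  *-pos {p} {q} 0<p 0<q =
    positive⁻¹ (p * q) {{pos*pos⇒pos p {{positive 0<p}} q {{positive 0<q}}}}

  *-monoˡ-< : ∀ {r p q} → 0ℚ < r → p < q → r * p < r * q
  *-monoˡ-< {r} 0<r = *-monoʳ-<-pos r {{positive 0<r}}

  *-monoˡ-≤ : ∀ {r p q} → 0ℚ ≤ r → p ≤ q → r * p ≤ r * q
  *-monoˡ-≤ {r} 0≤r = *-monoˡ-≤-nonNeg r {{nonNegative 0≤r}}

  *-monoʳ-< : ∀ {r p q} → 0ℚ < r → p < q → p * r < q * r
  *-monoʳ-< {r} 0<r = *-monoˡ-<-pos r {{positive 0<r}}

  *-monoʳ-≤ : ∀ {r p q} → 0ℚ ≤ r → p ≤ q → p * r ≤ q * r
  *-monoʳ-≤ {r} 0≤r = *-monoʳ-≤-nonNeg r {{nonNegative 0≤r}}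

  *-cancelˡ-< : ∀ {r p q} → 0ℚ ≤ r → r * p < r * q → p < q
  *-cancelˡ-< {r} 0≤r = *-cancelˡ-<-nonNeg r {{nonNegative 0≤r}}

  *-cancelʳ-< : ∀ {r p q} → 0ℚ ≤ r → p * r < q * r → p < q
  *-cancelʳ-< {r} 0≤r = *-cancelʳ-<-nonNeg r {{nonNegative 0≤r}}

  inv : ∀ {p} → 0ℚ < p → ℚ
  inv {p} 0<p = (1/ p) {{>-nonZero 0<p}}

  inv-pos : ∀ {p} (0<p : 0ℚ < p) → 0ℚ < inv 0<p
  inv-pos {p} 0<p = positive⁻¹ _ {{1/pos⇒pos p {{positive 0<p}}}}

  *-inv : ∀ {p} (0<p : 0ℚ < p) → p * inv 0<p ≡ 1ℚ
  *-inv {p} 0<p = *-inverseʳ p {{>-nonZero 0<p}}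

  *-inv-cancel : ∀ {p} (0<p : 0ℚ < p) q → q * inv 0<p * p ≡ q
  *-inv-cancel {p} 0<p q = trans (*-assoc q (inv 0<p) p)
    (trans (cong (q *_) (trans (*-comm (inv 0<p) p) (*-inv 0<p))) (*-identityʳ q))

  0<1 : 0ℚ < 1ℚ
  0<1 = positive⁻¹ 1ℚ

  <⇒0<- : ∀ {p q} → p < q → 0ℚ < q - p
  <⇒0<- {p} {q} p<q = subst (_< q - p) (+-inverseʳ p) (+-monoˡ-< (- p) p<q)

  +-pos-< : ∀ {e} p → 0ℚ < e → p < p + e
  +-pos-< {e} p 0<e = subst (_< p + e) (+-identityʳ p) (+-monoʳ-< p 0<e)

  ^-pos : ∀ {x} n → 0ℚ < x → 0ℚ < x ^ n
  ^-pos zero    0<x = 0<1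
  ^-pos (suc n) 0<x = *-pos 0<x (^-pos n 0<x)

  ^-nonNeg : ∀ {x} n → 0ℚ ≤ x → 0ℚ ≤ x ^ n
  ^-nonNeg     zero    0≤x = <⇒≤ 0<1
  ^-nonNeg {x} (suc n) 0≤x = subst (_≤ x * x ^ n) (*-zeroʳ x) (*-monoˡ-≤ 0≤x (^-nonNeg n 0≤x))

  ^-mono-≤ : ∀ {x y} n → 0ℚ ≤ x → x ≤ y → x ^ n ≤ y ^ n
  ^-mono-≤ zero    0≤x x≤y = ≤-refl
  ^-mono-≤ (suc n) 0≤x x≤y =
    ≤-trans (*-monoˡ-≤ 0≤x (^-mono-≤ n 0≤x x≤y))
            (*-monoʳ-≤ (^-nonNeg n (≤-trans 0≤x x≤y)) x≤y)

  ^-mono-< : ∀ {x y} n .{{_ : ℕ.NonZero n}} → 0ℚ ≤ x → x < y → x ^ n < y ^ n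
  ^-mono-< (suc n) 0≤x x<y =
    ≤-<-trans (*-monoˡ-≤ 0≤x (^-mono-≤ n 0≤x (<⇒≤ x<y)))
              (*-monoʳ-< (^-pos n (≤-<-trans 0≤x x<y)) x<y)

  ^-cancel-< : ∀ {x y} n → 0ℚ ≤ y → x ^ n < y ^ n → x < y
  ^-cancel-< {x} {y} n 0≤y xⁿ<yⁿ with x <? y
  ... | yes x<y = x<y
  ... | no  x≮y = ⊥-elim (<-irrefl refl (<-≤-trans xⁿ<yⁿ (^-mono-≤ n 0≤y (≮⇒≥ x≮y))))

  ^-swap : ∀ x m n → (x ^ m) ^ n ≡ (x ^ n) ^ m
  ^-swap x m n = trans (^-assocʳ x m n)
    (trans (cong (x ^_) (ℕ.*-comm m n)) (sym (^-assocʳ x n m)))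

  1≤^ : ∀ {x} n → 1ℚ ≤ x → 1ℚ ≤ x ^ n
  1≤^ zero 1≤x = ≤-refl
  1≤^ {x} (suc n) 1≤x = ≤-trans 1≤x
    (subst (_≤ x * x ^ n) (*-identityʳ x)
      (*-monoˡ-≤ (≤-trans (<⇒≤ 0<1) 1≤x) (1≤^ n 1≤x)))

  ≤^ : ∀ {x} n .{{_ : ℕ.NonZero n}} → 1ℚ ≤ x → x ≤ x ^ n
  ≤^ {x} (suc n) 1≤x = subst (_≤ x * x ^ n) (*-identityʳ x)
      (*-monoˡ-≤ (≤-trans (<⇒≤ 0<1) 1≤x) (1≤^ n 1≤x))

  ^≤1 : ∀ {x} n → 0ℚ ≤ x → x ≤ 1ℚ → x ^ n ≤ 1ℚ
  ^≤1 zero 0≤x x≤1 = ≤-refl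
  ^≤1 {x} (suc n) 0≤x x≤1 = ≤-trans
    (subst (x * x ^ n ≤_) (*-identityʳ x) (*-monoˡ-≤ 0≤x (^≤1 n 0≤x x≤1))) x≤1

  ^≤ : ∀ {x} n .{{_ : ℕ.NonZero n}} → 0ℚ ≤ x → x ≤ 1ℚ → x ^ n ≤ x
  ^≤ {x} (suc n) 0≤x x≤1 =
    subst (x * x ^ n ≤_) (*-identityʳ x) (*-monoˡ-≤ 0≤x (^≤1 n 0≤x x≤1))

  ⊓-pick : ∀ p q → ∃ λ r → r ≤ p × r ≤ q × (r ≡ p ⊎ r ≡ q)
  ⊓-pick p q with ≤-total p q
  ... | inj₁ p≤q = p , ≤-refl , p≤q , inj₁ refl
  ... | inj₂ q≤p = q , q≤p , ≤-refl , inj₂ refl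

  min< : ∀ {x} p q → x < p → x < q → ∃ λ r → x < r × r ≤ p × r ≤ q
  min< p q x<p x<q with ⊓-pick p q
  ... | r , r≤p , r≤q , inj₁ refl = r , x<p , r≤p , r≤q
  ... | r , r≤p , r≤q , inj₂ refl = r , x<q , r≤p , r≤q

  max< : ∀ {x} p q → p < x → q < x → ∃ λ r → r < x × p ≤ r × q ≤ r
  max< p q p<x q<x with ≤-total p q
  ... | inj₁ p≤q = q , q<x , p≤q , ≤-refl
  ... | inj₂ q≤p = p , p<x , ≤-refl , q≤p

  -- Continuity of x ↦ xⁿ at positive x.

  *-<-dense : ∀ {x m y} → 0ℚ < x → x * m < y → ∃ λ m′ → m < m′ × x * m′ < y
  *-<-dense {x} {m} {y} 0<x xm<y with <-dense xm<y
  ... | z , xm<z , z<y = inv 0<x * z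
    , *-cancelˡ-< (<⇒≤ 0<x) (subst (x * m <_) (sym eq) xm<z)
    , subst (_< y) (sym eq) z<y
    where
    eq : x * (inv 0<x * z) ≡ z
    eq = trans (sym (*-assoc x (inv 0<x) z))
           (trans (cong (_* z) (*-inv 0<x)) (*-identityˡ z))

  *->-dense : ∀ {x m y} → 0ℚ < x → y < x * m → ∃ λ m′ → m′ < m × y < x * m′
  *->-dense {x} {m} {y} 0<x y<xm with <-dense y<xm
  ... | z , y<z , z<xm = inv 0<x * z
    , *-cancelˡ-< (<⇒≤ 0<x) (subst (_< x * m) (sym eq) z<xm)
    , subst (y <_) (sym eq) y<z
    where
    eq : x * (inv 0<x * z) ≡ z
    eq = trans (sym (*-assoc x (inv 0<x) z))
           (trans (cong (_* z) (*-inv 0<x)) (*-identityˡ z))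

  ^-open-> : ∀ {x y} n → 0ℚ < x → x ^ n < y → ∃ λ x′ → x < x′ × x′ ^ n < y
  ^-open-> {x} zero 0<x 1<y = x + 1ℚ , +-pos-< x 0<1 , 1<y
  ^-open-> {x} {y} (suc n) 0<x lt with *-<-dense 0<x lt
  ... | m , xⁿ<m , xm<y with ^-open-> n 0<x xⁿ<m
                            | *-<-dense {m} {x} {y} (<-trans (^-pos n 0<x) xⁿ<m) (subst (_< y) (*-comm x m) xm<y)
  ... | x₁ , x<x₁ , x₁ⁿ<m | x₂ , x<x₂ , mx₂<y with min< x₁ x₂ x<x₁ x<x₂
  ... | x′ , x<x′ , x′≤x₁ , x′≤x₂ = x′ , x<x′ , ≤-<-trans
        (≤-trans (*-monoˡ-≤ 0≤x′ (≤-trans (^-mono-≤ n 0≤x′ x′≤x₁) (<⇒≤ x₁ⁿ<m)))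
          (subst (x′ * m ≤_) (*-comm x₂ m) (*-monoʳ-≤ (<⇒≤ (<-trans (^-pos n 0<x) xⁿ<m)) x′≤x₂)))
        mx₂<y
    where
    0≤x′ : 0ℚ ≤ x′
    0≤x′ = <⇒≤ (<-trans 0<x x<x′)

  ^-open-< : ∀ {x y} n → 0ℚ < x → 0ℚ < y → y < x ^ n → ∃ λ x′ → 0ℚ < x′ × x′ < x × y < x′ ^ n
  ^-open-< {x} zero 0<x 0<y y<1 with <-dense 0<x
  ... | x′ , 0<x′ , x′<x = x′ , 0<x′ , x′<x , y<1
  ^-open-< {x} {y} (suc n) 0<x 0<y lt with *->-dense 0<x lt
  ... | m , m<xⁿ , y<xm = step (*-cancelˡ-< (<⇒≤ 0<x) (subst (_< x * m) (sym (*-zeroʳ x)) (<-trans 0<y y<xm)))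
    where
    step : 0ℚ < m → ∃ λ x′ → 0ℚ < x′ × x′ < x × y < x′ * x′ ^ n
    step 0<m with ^-open-< n 0<x 0<m m<xⁿ
                | *->-dense {m} {x} {y} 0<m (subst (y <_) (*-comm x m) y<xm)
    ... | x₁ , 0<x₁ , x₁<x , m<x₁ⁿ | x₂ , x₂<x , y<mx₂ with max< x₁ x₂ x₁<x x₂<x
    ... | x′ , x′<x , x₁≤x′ , x₂≤x′ = x′ , 0<x′ , x′<x , <-≤-trans y<mx₂
          (≤-trans (*-monoˡ-≤ (<⇒≤ 0<m) x₂≤x′)
            (subst (_≤ x′ * x′ ^ n) (*-comm x′ m)
              (*-monoˡ-≤ (<⇒≤ 0<x′) (<⇒≤ (<-≤-trans m<x₁ⁿ (^-mono-≤ n (<⇒≤ 0<x₁) x₁≤x′))))))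
      where
      0<x′ : 0ℚ < x′
      0<x′ = <-≤-trans 0<x₁ x₁≤x′

  fromℕ-suc : ∀ n → fromℕ (suc n) ≡ 1ℚ + fromℕ n
  fromℕ-suc n = trans (sym (↥p/↧p≡p (fromℕ (suc n))))
    (cong (λ z → (+ 1 ℤ.+ z) / 1) (sym (ℤ.*-identityʳ (+ n))))

  <fromℕ : ∀ q → ∃ λ k → q < fromℕ k
  <fromℕ q@(mkℚ (+ n) d _) = suc n , *<* (ℤ.<-≤-trans
    (subst (ℤ._< + suc n) (sym (ℤ.*-identityʳ (+ n))) (ℤ.+<+ (ℕ.n<1+n n)))
    (subst (ℤ._≤ + suc n ℤ.* + suc d) (ℤ.*-identityʳ (+ suc n)) (ℤ.*-monoˡ-≤-nonNeg (+ suc n) (ℤ.+≤+ (ℕ.s≤s ℕ.z≤n)))))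
  <fromℕ q@(mkℚ -[1+ n ] d _) = 0 , *<* ℤ.-<+

  archimedean : ∀ {p} q → 0ℚ < p → ∃ λ k → q < fromℕ k * p
  archimedean {p} q 0<p with <fromℕ (q * inv 0<p)
  ... | k , lt = k , subst (_< fromℕ k * p) (*-inv-cancel 0<p q) (*-monoʳ-< 0<p lt)

  0≤fromℕ : ∀ n → 0ℚ ≤ fromℕ n
  0≤fromℕ n = nonNegative⁻¹ (fromℕ n)

  bernoulli : ∀ {e} k → 0ℚ < e → 1ℚ + fromℕ k * e ≤ (1ℚ + e) ^ k
  bernoulli {e} zero 0<e = ≤-reflexive (trans (cong (λ z → 1ℚ + z) (*-zeroˡ e)) (+-identityʳ 1ℚ))
  bernoulli {e} (suc k) 0<e = begin
    1ℚ + fromℕ (suc k) * e ≡⟨ cong (λ z → 1ℚ + z * e) (fromℕ-suc k) ⟩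
    1ℚ + (1ℚ + f) * e ≡⟨ sym (+-identityʳ _) ⟩
    1ℚ + (1ℚ + f) * e + 0ℚ
      ≤⟨ +-monoʳ-≤ (1ℚ + (1ℚ + f) * e) (subst (_≤ e * (f * e)) (*-zeroʳ e) (*-monoˡ-≤ (<⇒≤ 0<e) (subst (_≤ f * e) (*-zeroʳ f) (*-monoˡ-≤ (0≤fromℕ k) (<⇒≤ 0<e))))) ⟩
    1ℚ + (1ℚ + f) * e + e * (f * e)
      ≡⟨ solve 2 (λ f e → con 1ℚ :+ (con 1ℚ :+ f) :* e :+ e :* (f :* e) := (con 1ℚ :+ e) :* (con 1ℚ :+ f :* e)) refl f e ⟩
    (1ℚ + e) * (1ℚ + f * e) ≤⟨ *-monoˡ-≤ (<⇒≤ (<-trans 0<1 (+-pos-< 1ℚ 0<e))) (bernoulli k 0<e) ⟩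
    (1ℚ + e) * (1ℚ + e) ^ k ∎
    where
    open ≤-Reasoning
    open +-*-Solver
    f : ℚ
    f = fromℕ k

  ^-unbounded : ∀ {p q} B → 0ℚ < p → p < q → ∃ λ k → B * p ^ k < q ^ k
  ^-unbounded {p} {q} B 0<p p<q with archimedean B 0<e
    where
    0<e : 0ℚ < (q - p) * inv 0<p
    0<e = *-pos (<⇒0<- p<q) (inv-pos 0<p)
  ... | k , B<ke = k , (begin-strict
      B * p ^ k <⟨ *-monoʳ-< (^-pos k 0<p) B<ke ⟩
      fromℕ k * e * p ^ k <⟨ *-monoʳ-< (^-pos k 0<p) (subst (fromℕ k * e <_) (+-comm (fromℕ k * e) 1ℚ) (+-pos-< (fromℕ k * e) 0<1)) ⟩
      (1ℚ + fromℕ k * e) * p ^ k ≤⟨ *-monoʳ-≤ (<⇒≤ (^-pos k 0<p)) (bernoulli k (*-pos (<⇒0<- p<q) (inv-pos 0<p))) ⟩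
      (1ℚ + e) ^ k * p ^ k ≡⟨ sym (^-distrib-* (1ℚ + e) p k) ⟩
      ((1ℚ + e) * p) ^ k ≡⟨ cong (_^ k) eq ⟩
      q ^ k ∎)
    where
    open ≤-Reasoning
    open +-*-Solver
    e : ℚ
    e = (q - p) * inv 0<p
    eq : (1ℚ + e) * p ≡ q
    eq = trans (*-distribʳ-+ p 1ℚ e) (trans (cong₂ _+_ (*-identityˡ p) (*-inv-cancel 0<p (q - p)))
           (solve 2 (λ p q → p :+ (q :- p) := q) refl p q))

  1≤fromℕ : ∀ b .{{_ : ℕ.NonZero b}} → 1ℚ ≤ fromℕ b
  1≤fromℕ b@(suc _) = *≤* (subst₂ ℤ._≤_ refl (sym (ℤ.*-identityʳ (+ b))) (ℤ.+≤+ (ℕ.s≤s ℕ.z≤n)))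

  0<fromℕ : ∀ b .{{_ : ℕ.NonZero b}} → 0ℚ < fromℕ b
  0<fromℕ b = <-≤-trans 0<1 (1≤fromℕ b)

  1/b≡ : ∀ b → + 1 / suc b ≡ 1/ fromℕ (suc b)
  1/b≡ b = ↥p/↧p≡p (1/ fromℕ (suc b))

  b*1/b : ∀ b .{{_ : ℕ.NonZero b}} → fromℕ b * (+ 1 / b) ≡ 1ℚ
  b*1/b (suc b) = trans (cong (fromℕ (suc b) *_) (1/b≡ b)) (*-inverseʳ (fromℕ (suc b)))

  0<1/b : ∀ b .{{_ : ℕ.NonZero b}} → 0ℚ < + 1 / b
  0<1/b (suc b) = subst (0ℚ <_) (sym (1/b≡ b)) (positive⁻¹ (1/ fromℕ (suc b)))

  ^ᶻ-pos : ∀ b .{{_ : ℕ.NonZero b}} z → 0ℚ < b ^ᶻ z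
  ^ᶻ-pos b (+ n)    = ^-pos n (0<fromℕ b)
  ^ᶻ-pos b -[1+ n ] = ^-pos (suc n) (0<1/b b)

  ^ᶻ-suc : ∀ b .{{_ : ℕ.NonZero b}} z → b ^ᶻ ℤ.suc z ≡ fromℕ b * b ^ᶻ z
  ^ᶻ-suc b (+ n) = refl
  ^ᶻ-suc b -[1+ n ] = trans (lemma n) (sym
      (trans (sym (*-assoc (fromℕ b) (+ 1 / b) _)) (trans (cong (_* (+ 1 / b) ^ n) (b*1/b b)) (*-identityˡ _))))
    where
    lemma : ∀ n → b ^ᶻ ℤ.suc -[1+ n ] ≡ (+ 1 / b) ^ n
    lemma zero = refl
    lemma (suc n) = refl

  ^ᶻ-+ : ∀ b .{{_ : ℕ.NonZero b}} z n → b ^ᶻ (z ℤ.+ + n) ≡ b ^ᶻ z * fromℕ b ^ n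
  ^ᶻ-+ b z zero = trans (cong (b ^ᶻ_) (ℤ.+-identityʳ z)) (sym (*-identityʳ _))
  ^ᶻ-+ b z (suc n) = begin-equality
    b ^ᶻ (z ℤ.+ + suc n) ≡⟨ cong (b ^ᶻ_) (trans (sym (ℤ.+-assoc z (+ 1) (+ n))) (trans (cong (ℤ._+ + n) (ℤ.+-comm z (+ 1))) (ℤ.+-assoc (+ 1) z (+ n)))) ⟩
    b ^ᶻ ℤ.suc (z ℤ.+ + n) ≡⟨ ^ᶻ-suc b (z ℤ.+ + n) ⟩
    fromℕ b * b ^ᶻ (z ℤ.+ + n) ≡⟨ cong (fromℕ b *_) (^ᶻ-+ b z n) ⟩
    fromℕ b * (b ^ᶻ z * fromℕ b ^ n) ≡⟨ solve 3 (λ x y z → x :* (y :* z) := y :* (x :* z)) refl (fromℕ b) (b ^ᶻ z) (fromℕ b ^ n) ⟩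
    b ^ᶻ z * (fromℕ b * fromℕ b ^ n) ∎
    where
    open ≤-Reasoning
    open +-*-Solver

  ^ᶻ-* : ∀ b .{{_ : ℕ.NonZero b}} z k → b ^ᶻ (z ℤ.* + k) ≡ (b ^ᶻ z) ^ k
  ^ᶻ-* b (+ n) k = trans (cong (b ^ᶻ_) (sym (ℤ.pos-* n k))) (sym (^-assocʳ (fromℕ b) n k))
  ^ᶻ-* b -[1+ n ] zero = cong (b ^ᶻ_) (ℤ.*-zeroʳ -[1+ n ])
  ^ᶻ-* b -[1+ n ] (suc k) = sym (^-assocʳ (+ 1 / b) (suc n) (suc k))

  ^ᶻ-mono-≤ : ∀ b .{{_ : ℕ.NonZero b}} {z w} → z ℤ.≤ w → b ^ᶻ z ≤ b ^ᶻ w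
  ^ᶻ-mono-≤ b {z} {w} z≤w = subst₂ _≤_ (*-identityʳ (b ^ᶻ z))
      (trans (sym (^ᶻ-+ b z n)) (cong (b ^ᶻ_) eq))
      (*-monoˡ-≤ (<⇒≤ (^ᶻ-pos b z)) (1≤^ n (1≤fromℕ b)))
    where
    n : ℕ
    n = ℤ.∣ w ℤ.- z ∣
    eq : z ℤ.+ + n ≡ w
    eq = trans (cong (λ v → z ℤ.+ v) (ℤ.0≤i⇒+∣i∣≡i (ℤ.i≤j⇒0≤j-i z≤w)))
         (trans (cong (λ v → z ℤ.+ v) (ℤ.+-comm w (ℤ.- z)))
         (trans (sym (ℤ.+-assoc z (ℤ.- z) w)) (trans (cong (ℤ._+ w) (ℤ.+-inverseʳ z)) (ℤ.+-identityˡ w))))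

  2^ᶻ-mono-< : ∀ {z w} → z ℤ.< w → 2 ^ᶻ z < 2 ^ᶻ w
  2^ᶻ-mono-< {z} {w} z<w = <-≤-trans
    (subst₂ _<_ (*-identityˡ (2 ^ᶻ z)) (sym (^ᶻ-suc 2 z)) (*-monoʳ-< (^ᶻ-pos 2 z) (+-pos-< 1ℚ 0<1)))
    (^ᶻ-mono-≤ 2 (ℤ.i<j⇒suc[i]≤j z<w))

  halves : ∀ p → p * ½ + p * ½ ≡ p
  halves p = trans (sym (*-distribˡ-+ p ½ ½)) (*-identityʳ p)

  halve : ∀ {p} → 0ℚ < p → ∃ λ e → 0ℚ < e × e + e ≡ p
  halve {p} 0<p = p * ½ , *-pos 0<p (positive⁻¹ ½) , halves p

  +-cancel : ∀ p q → p + (q - p) ≡ q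
  +-cancel p q = trans (cong (λ z → p + z) (+-comm q (- p)))
    (trans (sym (+-assoc p (- p) q)) (trans (cong (_+ q) (+-inverseʳ p)) (+-identityˡ q)))

  -1< : ∀ q → q - 1ℚ < q
  -1< q = subst (q - 1ℚ <_) (trans (+-assoc q (- 1ℚ) 1ℚ) (trans (cong (λ z → q + z) (+-inverseˡ 1ℚ)) (+-identityʳ q))) (+-pos-< (q - 1ℚ) 0<1)

open ℚ-Lemmas

-- Two-sided Dedekind cuts: lower q means q < x and upper q means x < q.
-- Locatedness makes these the Dedekind reals also constructively.
record ℝ : Set₁ where
  field
    lower upper     : ℚ → Set
    lower-inhabited : ∃ lower
    upper-inhabited : ∃ upper
    lower-closed    : ∀ {p q} → p < q → lower q → lower p
    upper-closed    : ∀ {p q} → p < q → upper p → upper q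
    lower-open      : ∀ {p} → lower p → ∃ λ q → p < q × lower q
    upper-open      : ∀ {q} → upper q → ∃ λ p → p < q × upper p
    separated       : ∀ {p q} → lower p → upper q → p < q
    located         : ∀ {p q} → p < q → lower p ⊎ upper q

open ℝ

infix 4 _<ℝ_ _≤ℝ_

_<ℝ_ : ℝ → ℝ → Set
x <ℝ y = ∃ λ q → upper x q × lower y q

_≤ℝ_ : ℝ → ℝ → Set
x ≤ℝ y = ∀ q → lower x q → lower y q

fromℚ : ℚ → ℝ
fromℚ r .lower q = q < r
fromℚ r .upper q = r < q
fromℚ r .lower-inhabited = r - 1ℚ , -1< r
fromℚ r .upper-inhabited = r + 1ℚ , +-pos-< r 0<1
fromℚ r .lower-closed = <-trans
fromℚ r .upper-closed p<q r<p = <-trans r<p p<q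
fromℚ r .lower-open p<r = <-dense p<r
fromℚ r .upper-open r<q = let p , r<p , p<q = <-dense r<q in p , p<q , r<p
fromℚ r .separated = <-trans
fromℚ r .located {p} {q} p<q with p <? r
... | yes p<r = inj₁ p<r
... | no  p≮r = inj₂ (≤-<-trans (≮⇒≥ p≮r) p<q)

0ℝ : ℝ
0ℝ = fromℚ 0ℚ

module ℝ-Lemmas (x : ℝ) where

  lower-≤ : ∀ {p q} → p ≤ q → lower x q → lower x p
  lower-≤ {p} {q} p≤q lq with lower-open x lq
  ... | r , q<r , lr = lower-closed x (≤-<-trans p≤q q<r) lr

  upper-≤ : ∀ {p q} → p ≤ q → upper x p → upper x q
  upper-≤ {p} {q} p≤q up with upper-open x up
  ... | r , r<p , ur = upper-closed x (<-≤-trans r<p p≤q) ur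

  approximate : ∀ {ε} → 0ℚ < ε → ∃ λ a → lower x a × upper x (a + ε)
  approximate {ε} 0<ε = from (halve 0<ε) (lower-inhabited x) (upper-inhabited x)
    where
    open +-*-Solver
    Goal : Set
    Goal = ∃ λ a → lower x a × upper x (a + ε)
    walk : ∀ {e} → 0ℚ < e → e + e ≡ ε → ∀ k {a} → lower x a → upper x (a + fromℕ k * e) → Goal
    walk {e} 0<e 2e≡ε zero {a} la ua = ⊥-elim (<-irrefl refl
      (subst (a <_) (trans (cong (λ z → a + z) (*-zeroˡ e)) (+-identityʳ a)) (separated x la ua)))
    walk {e} 0<e 2e≡ε (suc k) {a} la ua =
      step (located x (subst (a + e <_) (+-assoc a e e) (+-pos-< (a + e) 0<e)))
      where
      eq : ∀ o f → a + (o + f) * e ≡ a + o * e + f * e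
      eq o f = solve 4 (λ a o f e → a :+ (o :+ f) :* e := a :+ o :* e :+ f :* e) refl a o f e
      step : lower x (a + e) ⊎ upper x (a + (e + e)) → Goal
      step (inj₁ l) = walk 0<e 2e≡ε k l (subst (upper x)
        (trans (cong (λ z → a + z * e) (fromℕ-suc k))
          (trans (eq 1ℚ (fromℕ k)) (cong (λ z → a + z + fromℕ k * e) (*-identityˡ e)))) ua)
      step (inj₂ u) = a , la , subst (λ z → upper x (a + z)) 2e≡ε u
    from : (∃ λ e → 0ℚ < e × e + e ≡ ε) → ∃ (lower x) → ∃ (upper x) → Goal
    from (e , 0<e , 2e≡ε) (a , la) (b , ub) = go (archimedean (b - a) 0<e)
      where
      go : (∃ λ k → b - a < fromℕ k * e) → Goal
      go (k , lt) = walk 0<e 2e≡ε k la (upper-closed x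
        (subst (_< a + fromℕ k * e) (+-cancel a b) (+-monoʳ-< a lt)) ub)

  positive-lower : lower x 0ℚ → 0ℝ <ℝ x
  positive-lower = lower-open x

open ℝ-Lemmas

infixl 6 _-ℝ_

_-ℝ_ : ℝ → ℝ → ℝ
(x -ℝ y) .lower q = ∃₂ λ a b → lower x a × upper y b × q < a - b
(x -ℝ y) .upper q = ∃₂ λ a b → upper x a × lower y b × a - b < q
(x -ℝ y) .lower-inhabited with lower-inhabited x | upper-inhabited y
... | a , la | b , ub = let q , q<a-b = lower-inhabited (fromℚ (a - b)) in q , a , b , la , ub , q<a-b
(x -ℝ y) .upper-inhabited with upper-inhabited x | lower-inhabited y
... | a , ua | b , lb = let q , a-b<q = upper-inhabited (fromℚ (a - b)) in q , a , b , ua , lb , a-b<q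
(x -ℝ y) .lower-closed p<q (a , b , la , ub , q<) = a , b , la , ub , <-trans p<q q<
(x -ℝ y) .upper-closed p<q (a , b , ua , lb , <p) = a , b , ua , lb , <-trans <p p<q
(x -ℝ y) .lower-open (a , b , la , ub , p<) = let q , p<q , q< = <-dense p< in q , p<q , a , b , la , ub , q<
(x -ℝ y) .upper-open (a , b , ua , lb , <q) = let p , <p , p<q = <-dense <q in p , p<q , a , b , ua , lb , <p
(x -ℝ y) .separated (a , b , la , ub , p<) (a′ , b′ , ua′ , lb′ , <q) =
  <-trans p< (<-trans (+-mono-< (separated x la ua′) (neg-antimono-< (separated y lb′ ub))) <q)
(x -ℝ y) .located {p} {q} p<q = from (<-dense p<q)
  where
  open ≤-Reasoning
  open +-*-Solver
  Goal : Set
  Goal = (∃₂ λ a b → lower x a × upper y b × p < a - b) ⊎ (∃₂ λ a b → upper x a × lower y b × a - b < q)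
  from : (∃ λ m → p < m × m < q) → Goal
  from (m , p<m , m<q) = split (halve (<⇒0<- p<m))
    where
    split : (∃ λ ε → 0ℚ < ε × ε + ε ≡ m - p) → Goal
    split (ε , 0<ε , 2ε≡) = decide (approximate x 0<ε) (approximate y 0<ε)
      where
      decide : (∃ λ a → lower x a × upper x (a + ε)) → (∃ λ b → lower y b × upper y (b + ε)) → Goal
      decide (a , la , ua) (b , lb , ub) with p <? a - (b + ε)
      ... | yes p< = inj₁ (a , b + ε , la , ub , p<)
      ... | no  p≮ = inj₂ (a + ε , b , ua , lb , ≤-<-trans (begin
          a + ε - b                 ≡⟨ solve 3 (λ a b h → a :+ h :- b := a :- (b :+ h) :+ (h :+ h)) refl a b ε ⟩
          a - (b + ε) + (ε + ε)     ≤⟨ +-monoˡ-≤ (ε + ε) (≮⇒≥ p≮) ⟩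
          p + (ε + ε)               ≡⟨ cong (λ z → p + z) 2ε≡ ⟩
          p + (m - p)               ≡⟨ +-cancel p m ⟩
          m                         ∎) m<q)

infixr 7 _·_

-- Since c > 0, q < c x exactly when q / c < x.
_·_ : (c : ℚ) .{{_ : Positive c}} → ℝ → ℝ
_·_ c x = scaled
  where
  0<c : 0ℚ < c
  0<c = positive⁻¹ c
  d : ℚ
  d = inv 0<c
  mono : ∀ {p q} → p < q → p * d < q * d
  mono = *-monoʳ-< (inv-pos 0<c)
  back : ∀ q → q * c * d ≡ q
  back q = trans (*-assoc q c d) (trans (cong (q *_) (*-inv 0<c)) (*-identityʳ q))
  cancel : ∀ {p q} → p * d < q → p < q * c
  cancel {p} {q} lt = subst (_< q * c) (*-inv-cancel 0<c p) (*-monoʳ-< 0<c lt)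
  cancel′ : ∀ {p q} → p < q * d → p * c < q
  cancel′ {p} {q} lt = subst (p * c <_) (*-inv-cancel 0<c q) (*-monoʳ-< 0<c lt)
  scaled : ℝ
  scaled .lower q = lower x (q * d)
  scaled .upper q = upper x (q * d)
  scaled .lower-inhabited = let a , la = lower-inhabited x in a * c , subst (lower x) (sym (back a)) la
  scaled .upper-inhabited = let a , ua = upper-inhabited x in a * c , subst (upper x) (sym (back a)) ua
  scaled .lower-closed p<q = lower-closed x (mono p<q)
  scaled .upper-closed p<q = upper-closed x (mono p<q)
  scaled .lower-open lp = let a , lt , la = lower-open x lp in a * c , cancel lt , subst (lower x) (sym (back a)) la
  scaled .upper-open uq = let a , lt , ua = upper-open x uq in a * c , cancel′ lt , subst (upper x) (sym (back a)) ua
  scaled .separated lp uq = *-cancelʳ-< (<⇒≤ (inv-pos 0<c)) (separated x lp uq)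
  scaled .located p<q = located x (mono p<q)

infixl 7 _÷ℝ_

-- For x, y > 0: q < x / y exactly when q b < a for some a < x and some b > y,
-- and x / y < q exactly when a < q b for some a > x and some 0 < b < y.
_÷ℝ_ : (x y : ℝ) → 0ℝ <ℝ x → 0ℝ <ℝ y → ℝ
(x ÷ℝ y) (_ , 0<u , lu) (_ , 0<v , lv) = quotient
  where
  0<x : lower x 0ℚ
  0<x = lower-closed x 0<u lu
  0<y : lower y 0ℚ
  0<y = lower-closed y 0<v lv

  L U : ℚ → Set
  L q = ∃₂ λ a b → lower x a × upper y b × q * b < a
  U q = ∃₂ λ a b → upper x a × lower y b × 0ℚ < b × a < q * b

  sep : ∀ {p q} → L p → U q → p < q
  sep {p} {q} (a , b , la , ub , pb<a) (a′ , b′ , ua′ , lb′ , 0<b′ , a′<qb′) with p <? q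
  ... | yes p<q = p<q
  ... | no  p≮q = ⊥-elim (<-irrefl refl (<-≤-trans qb′<qb qb≤)) 
    where
    0<q : 0ℚ < q
    0<q = *-cancelʳ-< (<⇒≤ 0<b′) (subst (_< q * b′) (sym (*-zeroˡ b′)) (<-trans (separated x 0<x ua′) a′<qb′))
    qb′<qb : q * b′ < q * b
    qb′<qb = *-monoˡ-< 0<q (separated y lb′ ub)
    qb≤ : q * b ≤ q * b′
    qb≤ = ≤-trans (*-monoʳ-≤ (<⇒≤ (separated y 0<y ub)) (≮⇒≥ p≮q))
            (<⇒≤ (<-trans pb<a (<-trans (separated x la ua′) a′<qb′)))

  loc : ∀ {p q} → p < q → L p ⊎ U q
  loc {p} {q} p<q with 0ℚ <? p
  ... | no  0≮p = inj₁ (nonpos (lower-open x 0<x) (upper-inhabited y))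
    where
    nonpos : (∃ λ a → 0ℚ < a × lower x a) → ∃ (upper y) → L p
    nonpos (a , 0<a , la) (b , ub) = a , b , la , ub , ≤-<-trans
      (subst (p * b ≤_) (*-zeroˡ b) (*-monoʳ-≤ (<⇒≤ (separated y 0<y ub)) (≮⇒≥ 0≮p))) 0<a
  ... | yes 0<p = from (<-dense p<q) (lower-open y 0<y)
    where
    open ≤-Reasoning
    from : (∃ λ m → p < m × m < q) → (∃ λ b → 0ℚ < b × lower y b) → L p ⊎ U q
    from (m , p<m , m<q) (b₀ , 0<b₀ , lb₀) = go (approximate y 0<ε)
      where
      ε : ℚ
      ε = b₀ * (m - p) * inv 0<p
      0<ε : 0ℚ < ε
      0<ε = *-pos (*-pos 0<b₀ (<⇒0<- p<m)) (inv-pos 0<p)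
      decide : ∀ {b} → b₀ ≤ b → lower y b → upper y (b + ε) → L p ⊎ U q
      decide {b} b₀≤b lb ub = pick (located x lt)
        where
        0<b : 0ℚ < b
        0<b = <-≤-trans 0<b₀ b₀≤b
        lt : p * (b + ε) < q * b
        lt = begin-strict
          p * (b + ε)               ≡⟨ *-distribˡ-+ p b ε ⟩
          p * b + p * ε             ≡⟨ cong (λ z → p * b + z) (trans (*-comm p ε) (*-inv-cancel 0<p (b₀ * (m - p)))) ⟩
          p * b + b₀ * (m - p)      ≤⟨ +-monoʳ-≤ (p * b) (*-monoʳ-≤ (<⇒≤ (<⇒0<- p<m)) b₀≤b) ⟩
          p * b + b * (m - p)       ≡⟨ cong (λ z → p * b + z) (*-comm b (m - p)) ⟩
          p * b + (m - p) * b       ≡⟨ sym (*-distribʳ-+ b p (m - p)) ⟩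
          (p + (m - p)) * b         ≡⟨ cong (_* b) (+-cancel p m) ⟩
          m * b                     <⟨ *-monoʳ-< 0<b m<q ⟩
          q * b                     ∎
        pick : lower x (p * (b + ε)) ⊎ upper x (q * b) → L p ⊎ U q
        pick (inj₁ l) = let a , lt , la = lower-open x l in inj₁ (a , b + ε , la , ub , lt)
        pick (inj₂ u) = let a , lt , ua = upper-open x u in inj₂ (a , b , ua , lb , 0<b , lt)
      go : (∃ λ b → lower y b × upper y (b + ε)) → L p ⊎ U q
      go (b , lb , ub) with ≤-total b₀ b
      ... | inj₁ b₀≤b = decide b₀≤b lb ub
      ... | inj₂ b≤b₀ = decide ≤-refl lb₀ (upper-≤ y (+-monoˡ-≤ ε b≤b₀) ub)

  inhabited-L : (∃ λ a → 0ℚ < a × lower x a) → ∃ (upper y) → ∃ L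
  inhabited-L (a , 0<a , la) (b , ub) = 0ℚ , a , b , la , ub , subst (_< a) (sym (*-zeroˡ b)) 0<a

  inhabited-U : ∃ (upper x) → (∃ λ b → 0ℚ < b × lower y b) → ∃ U
  inhabited-U (a , ua) (b , 0<b , lb) = (a + 1ℚ) * inv 0<b , a , b , ua , lb , 0<b
    , subst (a <_) (sym (*-inv-cancel 0<b (a + 1ℚ))) (+-pos-< a 0<1)

  open-L : ∀ {p} → L p → ∃ λ q → p < q × L q
  open-L {p} (a , b , la , ub , pb<a) =
    let q , p<q , bq<a = *-<-dense (separated y 0<y ub) (subst (_< a) (*-comm p b) pb<a)
    in q , p<q , a , b , la , ub , subst (_< a) (*-comm b q) bq<a

  open-U : ∀ {q} → U q → ∃ λ p → p < q × U p
  open-U {q} (a , b , ua , lb , 0<b , a<qb) =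
    let p , p<q , a<bp = *->-dense 0<b (subst (a <_) (*-comm q b) a<qb)
    in p , p<q , a , b , ua , lb , 0<b , subst (a <_) (*-comm b p) a<bp

  quotient : ℝ
  quotient .lower = L
  quotient .upper = U
  quotient .lower-inhabited = inhabited-L (lower-open x 0<x) (upper-inhabited y)
  quotient .upper-inhabited = inhabited-U (upper-inhabited x) (lower-open y 0<y)
  quotient .lower-closed p<q (a , b , la , ub , qb<a) =
    a , b , la , ub , <-trans (*-monoʳ-< (separated y 0<y ub) p<q) qb<a
  quotient .upper-closed p<q (a , b , ua , lb , 0<b , a<pb) =
    a , b , ua , lb , 0<b , <-trans a<pb (*-monoʳ-< 0<b p<q)
  quotient .lower-open = open-L
  quotient .upper-open = open-U
  quotient .separated = sep
  quotient .located = loc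

-- pow< b t q says bᵗ < q and <pow q b t says q < bᵗ, for rational t = m / d and
-- q ≥ 0: both sides of the comparison are raised to the power d.
pow< : (b : ℕ) .{{_ : ℕ.NonZero b}} → ℚ → ℚ → Set
pow< b t q = b ^ᶻ ↥ t < q ^ ↧ₙ t

<pow : ℚ → (b : ℕ) .{{_ : ℕ.NonZero b}} → ℚ → Set
<pow q b t = q ^ ↧ₙ t < b ^ᶻ ↥ t

module Power-Lemmas where

  /-cross : ∀ z d .{{_ : ℕ.NonZero d}} → ↥ (z / d) ℤ.* + d ≡ z ℤ.* ↧ (z / d)
  /-cross z (suc d-1) = from (toℚᵘ-fromℚᵘ (mkℚᵘ z d-1))
    where
    r : ℚ
    r = z / suc d-1
    from : toℚᵘ r ℚᵘ.≃ mkℚᵘ z d-1 → ↥ r ℤ.* + suc d-1 ≡ z ℤ.* ↧ r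
    from (ℚᵘ.*≡* eq) = trans (cong (ℤ._* + suc d-1) (sym (↥ᵘ-toℚᵘ r))) (trans eq (cong (z ℤ.*_) (↧ᵘ-toℚᵘ r)))

  </ : ∀ t z d .{{_ : ℕ.NonZero d}} → ↥ t ℤ.* + d ℤ.< z ℤ.* ↧ t → t < z / d
  </ t@(mkℚ _ _ _) z (suc d-1) lt = toℚᵘ-cancel-<
    (ℚᵘ.<-respʳ-≃ (ℚᵘ.≃-sym {toℚᵘ (z / suc d-1)} {mkℚᵘ z d-1} (toℚᵘ-fromℚᵘ (mkℚᵘ z d-1))) (ℚᵘ.*<* lt))

  /< : ∀ t z d .{{_ : ℕ.NonZero d}} → z ℤ.* ↧ t ℤ.< ↥ t ℤ.* + d → z / d < t
  /< t@(mkℚ _ _ _) z (suc d-1) lt = toℚᵘ-cancel-<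
    (ℚᵘ.<-respˡ-≃ (ℚᵘ.≃-sym {toℚᵘ (z / suc d-1)} {mkℚᵘ z d-1} (toℚᵘ-fromℚᵘ (mkℚᵘ z d-1))) (ℚᵘ.*<* lt))

  module _ (b : ℕ) .{{_ : ℕ.NonZero b}} {q : ℚ} (0≤q : 0ℚ ≤ q) where

    raise-up : ∀ z d z′ d′ .{{_ : ℕ.NonZero d′}} →
               z ℤ.* + d′ ℤ.≤ z′ ℤ.* + d → q ^ d < b ^ᶻ z → q ^ d′ < b ^ᶻ z′
    raise-up z d z′ d′ le lt = ^-cancel-< d (<⇒≤ (^ᶻ-pos b z′)) (begin-strict
      (q ^ d′) ^ d           ≡⟨ ^-swap q d′ d ⟩
      (q ^ d) ^ d′           <⟨ ^-mono-< d′ (^-nonNeg d 0≤q) lt ⟩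
      (b ^ᶻ z) ^ d′          ≡⟨ sym (^ᶻ-* b z d′) ⟩
      b ^ᶻ (z ℤ.* + d′)      ≤⟨ ^ᶻ-mono-≤ b le ⟩
      b ^ᶻ (z′ ℤ.* + d)      ≡⟨ ^ᶻ-* b z′ d ⟩
      (b ^ᶻ z′) ^ d          ∎)
      where open ≤-Reasoning

    raise-down : ∀ z d z′ d′ .{{_ : ℕ.NonZero d′}} →
                 z′ ℤ.* + d ℤ.≤ z ℤ.* + d′ → b ^ᶻ z < q ^ d → b ^ᶻ z′ < q ^ d′
    raise-down z d z′ d′ le lt = ^-cancel-< d (^-nonNeg d′ 0≤q) (begin-strict
      (b ^ᶻ z′) ^ d          ≡⟨ sym (^ᶻ-* b z′ d) ⟩
      b ^ᶻ (z′ ℤ.* + d)      ≤⟨ ^ᶻ-mono-≤ b le ⟩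
      b ^ᶻ (z ℤ.* + d′)      ≡⟨ ^ᶻ-* b z d′ ⟩
      (b ^ᶻ z) ^ d′          <⟨ ^-mono-< d′ (<⇒≤ (^ᶻ-pos b z)) lt ⟩
      (q ^ d) ^ d′           ≡⟨ ^-swap q d d′ ⟩
      (q ^ d′) ^ d           ∎)
      where open ≤-Reasoning

    <pow-≤ : ∀ {s t} → s ≤ t → <pow q b s → <pow q b t
    <pow-≤ {s} {t} s≤t = raise-up (↥ s) (↧ₙ s) (↥ t) (↧ₙ t) (drop-*≤* s≤t)

    pow<-≤ : ∀ {s t} → s ≤ t → pow< b t q → pow< b s q
    pow<-≤ {s} {t} s≤t = raise-down (↥ t) (↧ₙ t) (↥ s) (↧ₙ s) (drop-*≤* s≤t)

    <pow-/ : ∀ z d .{{_ : ℕ.NonZero d}} → q ^ d < b ^ᶻ z → <pow q b (z / d)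
    <pow-/ z d = raise-up z d (↥ (z / d)) (↧ₙ (z / d)) (ℤ.≤-reflexive (sym (/-cross z d)))

    pow<-/ : ∀ z d .{{_ : ℕ.NonZero d}} → b ^ᶻ z < q ^ d → pow< b (z / d) q
    pow<-/ z d = raise-down z d (↥ (z / d)) (↧ₙ (z / d)) (ℤ.≤-reflexive (/-cross z d))

  module _ (n : ℕ) .{{_ : ℕ.NonZero n}} where

    private
      x : ℚ
      x = fromℕ n
      0≤x : 0ℚ ≤ x
      0≤x = 0≤fromℕ n
      0<2 : 0ℚ < fromℕ 2
      0<2 = 0<fromℕ 2
      2≮1 : ¬ (fromℕ 2 * 1ℚ < 1ℚ)
      2≮1 = from-no (fromℕ 2 * 1ℚ <? 1ℚ)

    log₂-open-lower : ∀ {t} → pow< 2 t x → ∃ λ t′ → t < t′ × pow< 2 t′ x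
    log₂-open-lower {t@(mkℚ a d-1 _)} lt = from (^-unbounded (fromℕ 2) (^ᶻ-pos 2 a) lt)
      where
      d : ℕ
      d = suc d-1
      from : (∃ λ k → fromℕ 2 * (2 ^ᶻ a) ^ k < (x ^ d) ^ k) → ∃ λ t′ → t < t′ × pow< 2 t′ x
      from (zero , 2<1) = ⊥-elim (2≮1 2<1)
      from (k@(suc _) , lt) = z / (d ℕ.* k) , </ t z (d ℕ.* k) cross , pow<-/ 2 0≤x z (d ℕ.* k) lt′
        where
        z : ℤ
        z = ℤ.suc (a ℤ.* + k)
        cross : a ℤ.* + (d ℕ.* k) ℤ.< z ℤ.* + d
        cross = subst₂ ℤ._<_ (trans (assoc a (+ k) (+ d)) (cong (a ℤ.*_) (sym (ℤ.pos-* d k)))) refl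
                  (ℤ.*-monoʳ-<-pos (+ d) {a ℤ.* + k} {z} (ℤ.suc[i]≤j⇒i<j ℤ.≤-refl))
          where
          open ℤ-Solver
          assoc : ∀ a k d → a ℤ.* k ℤ.* d ≡ a ℤ.* (d ℤ.* k)
          assoc = solve 3 (λ a k d → a :* k :* d := a :* (d :* k)) refl
        lt′ : 2 ^ᶻ z < x ^ (d ℕ.* k)
        lt′ = subst₂ _<_ (trans (cong (fromℕ 2 *_) (sym (^ᶻ-* 2 a k))) (sym (^ᶻ-suc 2 (a ℤ.* + k)))) (^-assocʳ x d k) lt

    log₂-open-upper : ∀ {t} → <pow x 2 t → ∃ λ t′ → t′ < t × <pow x 2 t′
    log₂-open-upper {t@(mkℚ a d-1 _)} lt = from (^-unbounded (fromℕ 2) (^-pos d (0<fromℕ n)) lt)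
      where
      d : ℕ
      d = suc d-1
      from : (∃ λ k → fromℕ 2 * (x ^ d) ^ k < (2 ^ᶻ a) ^ k) → ∃ λ t′ → t′ < t × <pow x 2 t′
      from (zero , 2<1) = ⊥-elim (2≮1 2<1)
      from (k@(suc _) , lt) = z / (d ℕ.* k) , /< t z (d ℕ.* k) cross , <pow-/ 2 0≤x z (d ℕ.* k) lt′
        where
        z : ℤ
        z = ℤ.pred (a ℤ.* + k)
        cross : z ℤ.* + d ℤ.< a ℤ.* + (d ℕ.* k)
        cross = subst₂ ℤ._<_ refl (trans (assoc a (+ k) (+ d)) (cong (a ℤ.*_) (sym (ℤ.pos-* d k))))
                  (ℤ.*-monoʳ-<-pos (+ d) {z} {a ℤ.* + k} (ℤ.suc[i]≤j⇒i<j (ℤ.≤-reflexive (ℤ.suc-pred (a ℤ.* + k)))))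
          where
          open ℤ-Solver
          assoc : ∀ a k d → a ℤ.* k ℤ.* d ≡ a ℤ.* (d ℤ.* k)
          assoc = solve 3 (λ a k d → a :* k :* d := a :* (d :* k)) refl
        lt′ : x ^ (d ℕ.* k) < 2 ^ᶻ z
        lt′ = *-cancelˡ-< (<⇒≤ 0<2) (subst₂ _<_ (cong (fromℕ 2 *_) (^-assocʳ x d k))
                (trans (sym (^ᶻ-* 2 a k)) (trans (cong (2 ^ᶻ_) (sym (ℤ.suc-pred (a ℤ.* + k)))) (^ᶻ-suc 2 z))) lt)

    log₂-located : ∀ {p q} → p < q → pow< 2 p x ⊎ <pow x 2 q
    log₂-located {p} {q} p<q with 2 ^ᶻ ↥ p <? x ^ ↧ₙ p
    ... | yes lt = inj₁ lt
    ... | no ≮ = inj₂ (^-cancel-< (↧ₙ p) (<⇒≤ (^ᶻ-pos 2 (↥ q))) (begin-strict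
      (x ^ ↧ₙ q) ^ ↧ₙ p           ≡⟨ ^-swap x (↧ₙ q) (↧ₙ p) ⟩
      (x ^ ↧ₙ p) ^ ↧ₙ q           ≤⟨ ^-mono-≤ (↧ₙ q) (^-nonNeg (↧ₙ p) 0≤x) (≮⇒≥ ≮) ⟩
      (2 ^ᶻ ↥ p) ^ ↧ₙ q           ≡⟨ sym (^ᶻ-* 2 (↥ p) (↧ₙ q)) ⟩
      2 ^ᶻ (↥ p ℤ.* ↧ q)          <⟨ 2^ᶻ-mono-< (drop-*<* p<q) ⟩
      2 ^ᶻ (↥ q ℤ.* ↧ p)          ≡⟨ ^ᶻ-* 2 (↥ q) (↧ₙ p) ⟩
      (2 ^ᶻ ↥ q) ^ ↧ₙ p           ∎))
      where open ≤-Reasoning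

    log₂-separated : ∀ {p q} → pow< 2 p x → <pow x 2 q → p < q
    log₂-separated {p} {q} lp uq with p <? q
    ... | yes p<q = p<q
    ... | no  p≮q = ⊥-elim (<-asym uq (pow<-≤ 2 0≤x (≮⇒≥ p≮q) lp))

    log₂-lower-inhabited : pow< 2 (fromℤ -[1+ 0 ]) x
    log₂-lower-inhabited = <-≤-trans (from-yes ((+ 1 / 2) ^ 1 <? 1ℚ)) (subst (1ℚ ≤_) (sym (*-identityʳ x)) (1≤fromℕ n))

    log₂-upper-inhabited : <pow x 2 (fromℕ n)
    log₂-upper-inhabited = subst (_< fromℕ 2 ^ n) (sym (*-identityʳ x)) (n<2^n n)
      where
      open ≤-Reasoning
      n<2^n : ∀ n → fromℕ n < fromℕ 2 ^ n
      n<2^n zero = 0<1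
      n<2^n (suc n) = begin-strict
        fromℕ (suc n) ≡⟨ fromℕ-suc n ⟩
        1ℚ + fromℕ n <⟨ +-monoʳ-< 1ℚ (n<2^n n) ⟩
        1ℚ + fromℕ 2 ^ n ≤⟨ +-monoˡ-≤ (fromℕ 2 ^ n) {1ℚ} {fromℕ 2 ^ n} (1≤^ {fromℕ 2} n (1≤fromℕ 2)) ⟩
        fromℕ 2 ^ n + fromℕ 2 ^ n ≡⟨ sym (cong₂ _+_ (*-identityˡ (fromℕ 2 ^ n)) (*-identityˡ (fromℕ 2 ^ n))) ⟩
        1ℚ * fromℕ 2 ^ n + 1ℚ * fromℕ 2 ^ n ≡⟨ sym (*-distribʳ-+ (fromℕ 2 ^ n) 1ℚ 1ℚ) ⟩
        fromℕ 2 * fromℕ 2 ^ n ∎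

open Power-Lemmas

-- t < log₂ n exactly when 2ᵗ < n.  Only a quotient of two logarithms is used
-- below, and this does not depend on the base.
log₂ : (n : ℕ) .{{_ : ℕ.NonZero n}} → ℝ
log₂ n .lower t = pow< 2 t (fromℕ n)
log₂ n .upper t = <pow (fromℕ n) 2 t
log₂ n .lower-inhabited = fromℤ -[1+ 0 ] , log₂-lower-inhabited n
log₂ n .upper-inhabited = fromℕ n , log₂-upper-inhabited n
log₂ n .lower-closed p<q = pow<-≤ 2 (0≤fromℕ n) (<⇒≤ p<q)
log₂ n .upper-closed p<q = <pow-≤ 2 (0≤fromℕ n) (<⇒≤ p<q)
log₂ n .lower-open = log₂-open-lower n
log₂ n .upper-open = log₂-open-upper n
log₂ n .separated {p} {q} = log₂-separated n {p} {q}
log₂ n .located {p} {q} = log₂-located n {p} {q}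

infixr 8 _^ℝ_

-- For b ≥ 1, bˣ is the supremum of bᵗ over rational t < x and the infimum of bᵗ
-- over rational t > x.
_^ℝ_ : (b : ℕ) .{{_ : ℕ.NonZero b}} → ℝ → ℝ
_^ℝ_ b x = power
  where
  L U : ℚ → Set
  L q = q ≤ 0ℚ ⊎ ∃ λ t → lower x t × <pow q b t
  U q = 0ℚ < q × ∃ λ t → upper x t × pow< b t q

  down : ∀ {p q} → p < q → L q → L p
  down p<q (inj₁ q≤0) = inj₁ (<⇒≤ (<-≤-trans p<q q≤0))
  down {p} p<q (inj₂ (t , lt , q<)) with 0ℚ <? p
  ... | no  0≮p = inj₁ (≮⇒≥ 0≮p)
  ... | yes 0<p = inj₂ (t , lt , ≤-<-trans (^-mono-≤ (↧ₙ t) (<⇒≤ 0<p) (<⇒≤ p<q)) q<)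

  up : ∀ {p q} → p < q → U p → U q
  up p<q (0<p , t , ut , <p) =
    <-trans 0<p p<q , t , ut , <-≤-trans <p (^-mono-≤ (↧ₙ t) (<⇒≤ 0<p) (<⇒≤ p<q))

  below-1 : ∀ t → lower x t → ∃ λ q → 0ℚ < q × L q
  below-1 t lt = pick (min< 1ℚ (b ^ᶻ ↥ t) 0<1 (^ᶻ-pos b (↥ t)))
    where
    pick : (∃ λ r → 0ℚ < r × r ≤ 1ℚ × r ≤ b ^ᶻ ↥ t) → ∃ λ q → 0ℚ < q × L q
    pick (r , 0<r , r≤1 , r≤) = let q , 0<q , q<r = <-dense 0<r in
      q , 0<q , inj₂ (t , lt , ≤-<-trans (^≤ (↧ₙ t) (<⇒≤ 0<q) (<⇒≤ (<-≤-trans q<r r≤1))) (<-≤-trans q<r r≤))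

  open-L : ∀ {p} → L p → ∃ λ q → p < q × L q
  open-L {p} lp with 0ℚ <? p
  ... | no 0≮p = let t , lt = lower-inhabited x
                     q , 0<q , lq = below-1 t lt
                 in q , ≤-<-trans (≮⇒≥ 0≮p) 0<q , lq
  open-L (inj₁ p≤0) | yes 0<p = ⊥-elim (<-irrefl refl (<-≤-trans 0<p p≤0))
  open-L (inj₂ (t , lt , p<)) | yes 0<p =
    let q , p<q , q< = ^-open-> (↧ₙ t) 0<p p< in q , p<q , inj₂ (t , lt , q<)

  open-U : ∀ {q} → U q → ∃ λ p → p < q × U p
  open-U (0<q , t , ut , <q) =
    let p , 0<p , p<q , <p = ^-open-< (↧ₙ t) 0<q (^ᶻ-pos b (↥ t)) <q
    in p , p<q , 0<p , t , ut , <p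

  sep : ∀ {p q} → L p → U q → p < q
  sep (inj₁ p≤0) (0<q , _) = ≤-<-trans p≤0 0<q
  sep {p} {q} (inj₂ (s , ls , p<)) (0<q , t , ut , <q) with 0ℚ <? p
  ... | no  0≮p = ≤-<-trans (≮⇒≥ 0≮p) 0<q
  ... | yes 0<p = ^-cancel-< (↧ₙ t) (<⇒≤ 0<q)
        (<-trans (<pow-≤ b (<⇒≤ 0<p) (<⇒≤ (separated x ls ut)) p<) <q)

  loc-pos : ∀ {p q} → 0ℚ < p → p < q → (∃ λ k → fromℕ b * p ^ k < q ^ k) → L p ⊎ U q
  loc-pos 0<p p<q (zero , b<1) =
    ⊥-elim (<-irrefl refl (<-≤-trans b<1 (subst (1ℚ ≤_) (sym (*-identityʳ (fromℕ b))) (1≤fromℕ b))))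
  loc-pos {p} {q} 0<p p<q (k@(suc _) , bpᵏ<qᵏ) = decide (approximate x {1/ fromℕ k} (positive⁻¹ (1/ fromℕ k)))
    where
    open ≤-Reasoning
    0<q : 0ℚ < q
    0<q = <-trans 0<p p<q
    decide : (∃ λ a → lower x a × upper x (a + 1/ fromℕ k)) → L p ⊎ U q
    decide (a@(mkℚ z d-1 _) , la , ua) with p ^ suc d-1 <? b ^ᶻ z
    ... | yes p< = inj₁ (inj₂ (a , la , p<))
    ... | no  p≮ = inj₂ (0<q , a + 1/ fromℕ k , ua
                   , pow<-/ b (<⇒≤ 0<q) (z ℤ.* + k ℤ.+ + 1 ℤ.* + d) (d ℕ.* k) (begin-strict
        b ^ᶻ (z ℤ.* + k ℤ.+ + 1 ℤ.* + d)   ≡⟨ cong (λ w → b ^ᶻ (z ℤ.* + k ℤ.+ w)) (ℤ.*-identityˡ (+ d)) ⟩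
        b ^ᶻ (z ℤ.* + k ℤ.+ + d)           ≡⟨ ^ᶻ-+ b (z ℤ.* + k) d ⟩
        b ^ᶻ (z ℤ.* + k) * fromℕ b ^ d     ≡⟨ cong (_* fromℕ b ^ d) (^ᶻ-* b z k) ⟩
        (b ^ᶻ z) ^ k * fromℕ b ^ d         ≤⟨ *-monoʳ-≤ (<⇒≤ (^-pos d (0<fromℕ b))) (^-mono-≤ k (<⇒≤ (^ᶻ-pos b z)) (≮⇒≥ p≮)) ⟩
        (p ^ d) ^ k * fromℕ b ^ d          ≡⟨ cong (_* fromℕ b ^ d) (^-swap p d k) ⟩
        (p ^ k) ^ d * fromℕ b ^ d          ≡⟨ *-comm ((p ^ k) ^ d) (fromℕ b ^ d) ⟩
        fromℕ b ^ d * (p ^ k) ^ d          ≡⟨ sym (^-distrib-* (fromℕ b) (p ^ k) d) ⟩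
        (fromℕ b * p ^ k) ^ d              <⟨ ^-mono-< d (<⇒≤ (*-pos (0<fromℕ b) (^-pos k 0<p))) bpᵏ<qᵏ ⟩
        (q ^ k) ^ d                        ≡⟨ ^-swap q k d ⟩
        (q ^ d) ^ k                        ≡⟨ ^-assocʳ q d k ⟩
        q ^ (d ℕ.* k)                      ∎))
      where
      d : ℕ
      d = suc d-1

  loc : ∀ {p q} → p < q → L p ⊎ U q
  loc {p} {q} p<q with 0ℚ <? p
  ... | no  0≮p = inj₁ (inj₁ (≮⇒≥ 0≮p))
  ... | yes 0<p = loc-pos 0<p p<q (^-unbounded (fromℕ b) 0<p p<q)

  inhabited-U : ∃ (upper x) → ∃ U
  inhabited-U (t , ut) = B + 1ℚ , <-trans 0<B B<B+1 , t , ut , <-≤-trans B<B+1 (≤^ (↧ₙ t) 1≤B+1)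
    where
    B : ℚ
    B = b ^ᶻ ↥ t
    0<B : 0ℚ < B
    0<B = ^ᶻ-pos b (↥ t)
    B<B+1 : B < B + 1ℚ
    B<B+1 = +-pos-< B 0<1
    1≤B+1 : 1ℚ ≤ B + 1ℚ
    1≤B+1 = subst (_≤ B + 1ℚ) (+-identityˡ 1ℚ) (+-monoˡ-≤ 1ℚ (<⇒≤ 0<B))

  power : ℝ
  power .lower = L
  power .upper = U
  power .lower-inhabited = 0ℚ , inj₁ ≤-refl
  power .upper-inhabited = inhabited-U (upper-inhabited x)
  power .lower-closed = down
  power .upper-closed = up
  power .lower-open = open-L
  power .upper-open = open-U
  power .separated = sep
  power .located = loc

log₂-positive : ∀ n .{{_ : ℕ.NonTrivial n}} → 0ℝ <ℝ log₂ n {{ℕ.nonTrivial⇒nonZero n}}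
log₂-positive n@(suc (suc m)) = positive-lower (log₂ n)
  (subst (1ℚ <_) (sym (trans (*-identityʳ (fromℕ n)) (fromℕ-suc (suc m)))) (+-pos-< 1ℚ (0<fromℕ (suc m))))

·-positive : ∀ c .{{_ : Positive c}} x → 0ℝ <ℝ x → 0ℝ <ℝ c · x
·-positive c x (_ , 0<u , lu) = positive-lower (c · x)
  (subst (lower x) (sym (*-zeroˡ (inv (positive⁻¹ c)))) (lower-closed x 0<u lu))

-- α = log 15 / (3 log 5)
α : ℝ
α = (log₂ 15 ÷ℝ (fromℕ 3 · log₂ 5)) (log₂-positive 15) (·-positive (fromℕ 3) (log₂ 5) (log₂-positive 5))

record LinearForm (s : ℕ) : Set where
  field
    coefficients : Vec ℤ s

  c : Fin s → ℤ
  c = lookup coefficients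

  field
    nonzero  : ∀ i → c i ≢ 0ℤ
    sum-zero : sum c ≡ 0ℤ

module _ {s : ℕ} (L : LinearForm s) where
  open LinearForm L

  evaluate : Vec ℤ s → ℤ
  evaluate x = sum (λ i → c i ℤ.* lookup x i)

  -- The block containing i of the partition of the indices by equality of the
  -- values xⱼ; every block of that partition is of this form.
  block : Vec ℤ s → Fin s → Subset s
  block x i = tabulate (λ j → does (lookup x i ℤ.≟ lookup x j))

  Trivial : Vec ℤ s → Set
  Trivial x = ∀ i → sum (λ j → if lookup (block x i) j then c j else 0ℤ) ≡ 0ℤ

  Free : Pred ℤ 0ℓ → Set
  Free A = ∀ x → All A x → evaluate x ≡ 0ℤ → Trivial x

-- Subset N stands for the subsets of {1, …, N}: i : Fin N represents i + 1.
⟦_⟧ : ∀ {N} → Subset N → Pred ℤ 0ℓ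
⟦ S ⟧ z = ∃ λ i → i Subset.∈ S × z ≡ + suc (toℕ i)

subsets : ∀ N → List (Subset N)
subsets zero    = [] List.∷ List.[]
subsets (suc N) = List.map (inside ∷_) (subsets N) ++ List.map (outside ∷_) (subsets N)

all⟦⟧? : ∀ {N} (S : Subset N) s {P : Vec ℤ s → Set} →
        (∀ x → Dec (P x)) → Dec (∀ x → All ⟦ S ⟧ x → P x)
all⟦⟧? S zero    P? = map′ (λ { p [] [] → p }) (λ f → f [] []) (P? [])
all⟦⟧? S (suc s) {P} P? =
  map′ (λ { f (_ ∷ x) ((i , i∈S , refl) ∷ x∈S) → f i i∈S x x∈S })
       (λ f i i∈S x x∈S → f _ ((i , i∈S , refl) ∷ x∈S))
       (Fin.all? λ i → (i Subset.∈? S) →-dec all⟦⟧? S s (λ x → P? (+ suc (toℕ i) ∷ x)))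

module _ {s : ℕ} (L : LinearForm s) where

  free? : ∀ {N} (S : Subset N) → Dec (Free L ⟦ S ⟧)
  free? S = all⟦⟧? S s λ x →
    (evaluate L x ℤ.≟ 0ℤ) →-dec Fin.all? λ i → _ ℤ.≟ 0ℤ

  -- r-upper and r-attained show that this is the maximum of |A| over the L-free
  -- A ⊆ {1, …, N}.
  r : ℕ → ℕ
  r N = max 0 (List.map Subset.∣_∣ (filter free? (subsets N)))

∈-subsets : ∀ {N} (S : Subset N) → S List.∈ subsets N
∈-subsets []            = here refl
∈-subsets (inside  ∷ S) = ∈-++⁺ˡ (∈-map⁺ (inside ∷_) (∈-subsets S))
∈-subsets (outside ∷ S) = ∈-++⁺ʳ (List.map (inside ∷_) (subsets _)) (∈-map⁺ (outside ∷_) (∈-subsets S))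

module _ {s : ℕ} (L : LinearForm s) where

  r-upper : ∀ {N} (S : Subset N) → Free L ⟦ S ⟧ → Subset.∣ S ∣ ℕ.≤ r L N
  r-upper S free = ListAll.lookup (xs≤max 0 _) (∈-map⁺ Subset.∣_∣ (∈-filter⁺ (free? L) (∈-subsets S) free))

  r-attained : ∀ N → ∃ λ (S : Subset N) → Free L ⟦ S ⟧ × Subset.∣ S ∣ ≡ r L N
  r-attained N = [ empty , found ]′ (argmax-sel id 0 (List.map Subset.∣_∣ (filter (free? L) (subsets N))))
    where
    Attained : Set
    Attained = ∃ λ (S : Subset N) → Free L ⟦ S ⟧ × Subset.∣ S ∣ ≡ r L N
    ⊥-void : ∀ {s} {x : Vec ℤ s} → Fin s → All ⟦ Subset.⊥ {N} ⟧ x → ⊥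
    ⊥-void _ ((_ , i∈⊥ , _) ∷ _) = Subset.∉⊥ i∈⊥
    empty : r L N ≡ 0 → Attained
    empty r≡0 = Subset.⊥ , (λ x x∈ _ i → ⊥-elim (⊥-void i x∈)) , trans (Subset.∣⊥∣≡0 N) (sym r≡0)
    found : r L N List.∈ List.map Subset.∣_∣ (filter (free? L) (subsets N)) → Attained
    found r∈ with ∈-map⁻ Subset.∣_∣ r∈
    ... | S , S∈ , eq = S , proj₂ (∈-filter⁻ (free? L) {xs = subsets N} S∈) , sym eq

-- 3x + y - 2z - 2w
L₃ : LinearForm 4
L₃ = record
  { coefficients = + 3 ∷ + 1 ∷ -[1+ 1 ] ∷ -[1+ 1 ] ∷ []
  ; nonzero      = λ { zero () ; (suc zero) () ; (suc (suc zero)) () ; (suc (suc (suc zero))) () }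
  ; sum-zero     = refl
  }

{-# OPTIONS --safe #-}
module Submission where

open import Defs
open import Data.Integer.Base using (+_)
open import Data.Nat.Base using (ℕ; NonZero; _≥_)
open import Data.Product.Base using (_×_; ∃-syntax)
open import Data.Rational.Base using (_/_)

-- Modulo 5 the equation 3x + y = 2z + 2w becomes x + z + w = 3y.  There are 15 points of 𝔽₅³ with
-- weights f such that every solution of x + z + w = 3y in them that is not constant satisfies
-- f(x) + f(z) + f(w) > 3f(y).  Hence the words of length n in these points having a prescribed total
-- weight contain only constant solutions, and by the pigeonhole principle some total weight leaves
-- s ≥ 15ⁿ / (183n + 1) words in 𝔽₅³ⁿ.  Take k such words as the base 5 digits of a vector of 3n
-- integers below 5ᵏ: a solution of 3x + y = 2z + 2w is constant in the lowest digit, so this digit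
-- cancels without a carry, and so on.  Writing the 3n coordinates in base 4 · 5ᵏ, again without
-- carries, gives an L₃-free set of size sᵏ below (4 · 5ᵏ)³ⁿ.  The exponent tends to log 15 / (3 log 5)
-- as first k and then n tend to infinity.

open import Data.Product.Base using (_,_; proj₁; proj₂; ∃; uncurry)
open import Data.Sum.Base using (_⊎_; inj₁; inj₂)
open import Relation.Binary.PropositionalEquality using (_≡_; refl; sym; trans; cong; cong₂; subst; subst₂; module ≡-Reasoning)
open import Relation.Nullary using (Dec; yes; no; contradiction)
open import Relation.Nullary.Decidable using (from-yes; map′; dec-true; _×-dec_; _⊎-dec_; _→-dec_)

module Counting where

  open import Data.Fin.Base using (Fin; zero; suc; toℕ; fromℕ<; remQuot; combine)
  open import Data.Fin.Properties using (all?; combine-remQuot; toℕ-fromℕ<) renaming (_≟_ to _≟ᶠ_; suc-injective to suc-injectiveᶠ)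
  open import Data.Fin.Subset using (Subset; inside; outside; _∈_; _∉_; ∣_∣; ⊥)
  open import Data.Fin.Subset.Properties using (∉⊥; ∣⊥∣≡0)
  open import Data.Integer.Base as ℤ using (-[1+_]; 0ℤ)
  import Data.Integer.Properties as ℤ
  open import Data.Integer.Solver using () renaming (module +-*-Solver to ℤ-Solver)
  open import Data.List.Base as List using (List; length; filter; allFin)
  open import Data.List.Properties using (length-tabulate)
  open import Data.List.Membership.Propositional.Properties using (∈-lookup)
  import Data.List.Relation.Unary.All as ListAll
  open import Data.List.Relation.Unary.All.Properties using (all-filter) renaming (filter⁺ to all-filter⁺)
  open import Data.List.Relation.Unary.AllPairs using (_∷_)
  open import Data.List.Relation.Unary.Unique.Propositional using (Unique)
  open import Data.List.Relation.Unary.Unique.Propositional.Properties using (filter⁺; allFin⁺)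
  open import Data.Nat.Base using (zero; suc; _+_; _*_; _^_; _≤_; _<_; z≤n; s≤s; >-nonZero⁻¹)
  open import Data.Nat.DivMod using (_%_; m<n⇒m%n≡m; [m+kn]%n≡m%n)
  open import Data.Nat.Properties
  open import Data.Nat.Solver using (module +-*-Solver)
  open import Data.Vec.Base using (Vec; []; _∷_; _++_; replicate; zipWith; lookup; here; there; _[_]≔_)
  open import Data.Vec.Properties using ([]=⇒lookup; lookup⇒[]=; lookup∘update′; lookup-replicate)
  open import Data.Vec.Relation.Unary.All as All using (All; []; _∷_)
  open import Data.Vec.Relation.Unary.All.Properties using (++⁺)
  open import Function.Base using (_∘_)
  open import Function.Definitions using (Injective)
  open import Level using (0ℓ)
  open import Relation.Unary using (Pred; Decidable)
  open import Relation.Unary.Properties using (∁?)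

  -- The equation over ℕ and modulo 5

  Solution : ℕ → ℕ → ℕ → ℕ → Set
  Solution x y z w = 3 * x + y ≡ 2 * (z + w)

  -- Multiplying by 2 and collecting terms turns this into x + z + w ≡ 3y modulo 5, so `y` is the
  -- mean of the other three in 𝔽₅.
  Solution₅ : ℕ → ℕ → ℕ → ℕ → Set
  Solution₅ x y z w = (3 * x + y) % 5 ≡ (2 * (z + w)) % 5

  Constant : {A : Set} → A → A → A → A → Set
  Constant x y z w = x ≡ y × x ≡ z × x ≡ w

  solution-constant : ∀ x → Solution x x x x
  solution-constant = solve 1 (λ x → con 3 :* x :+ x := con 2 :* (x :+ x)) refl
    where open +-*-Solver

  -- Constancy is asked of the indices and not only of their images. This makes `e` injective as
  -- well, so that the size of the index set is the size of the free set.
  Rigid : {A : Set} → (A → ℕ) → Set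
  Rigid e = ∀ x y z w → Solution (e x) (e y) (e z) (e w) → Constant x y z w

  -- Splits off the lowest digit in base B, for B = 5 as well as for the packing base. The multiple
  -- of B has B on the right, the form that remainders and right cancellation expect.
  shiftˡ : ∀ B x y x′ y′ → 3 * (x + B * x′) + (y + B * y′) ≡ (3 * x + y) + (3 * x′ + y′) * B
  shiftˡ = solve 5 (λ B x y x′ y′ → con 3 :* (x :+ B :* x′) :+ (y :+ B :* y′) := (con 3 :* x :+ y) :+ (con 3 :* x′ :+ y′) :* B) refl
    where open +-*-Solver

  shiftʳ : ∀ B z w z′ w′ → 2 * ((z + B * z′) + (w + B * w′)) ≡ 2 * (z + w) + 2 * (z′ + w′) * B
  shiftʳ = solve 5 (λ B z w z′ w′ → con 2 :* ((z :+ B :* z′) :+ (w :+ B :* w′)) := con 2 :* (z :+ w) :+ con 2 :* (z′ :+ w′) :* B) refl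
    where open +-*-Solver

  data Pointwise₄ {A : Set} (R : A → A → A → A → Set) :
       ∀ {n} → Vec A n → Vec A n → Vec A n → Vec A n → Set where
    []  : Pointwise₄ R [] [] [] []
    _∷_ : ∀ {n x y z w} {xs ys zs ws : Vec A n} →
          R x y z w → Pointwise₄ R xs ys zs ws → Pointwise₄ R (x ∷ xs) (y ∷ ys) (z ∷ zs) (w ∷ ws)

  ++⁻ : ∀ {A : Set} {R : A → A → A → A → Set} {m n} (xs ys zs ws : Vec A m) {xs′ ys′ zs′ ws′ : Vec A n} →
        Pointwise₄ R (xs ++ xs′) (ys ++ ys′) (zs ++ zs′) (ws ++ ws′) →
        Pointwise₄ R xs ys zs ws × Pointwise₄ R xs′ ys′ zs′ ws′
  ++⁻ [] [] [] [] p = [] , p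
  ++⁻ (_ ∷ xs) (_ ∷ ys) (_ ∷ zs) (_ ∷ ws) (r ∷ p) =
    let q , q′ = ++⁻ xs ys zs ws p in r ∷ q , q′

  remQuot-injective : ∀ {m} n {i j : Fin (m * n)} → remQuot {m} n i ≡ remQuot {m} n j → i ≡ j
  remQuot-injective {m} n {i} {j} eq =
    trans (sym (combine-remQuot {m} n i)) (trans (cong (uncurry combine) eq) (combine-remQuot {m} n j))

  constant-remQuot : ∀ {m} n {x y z w : Fin (m * n)} →
                     let q = λ i → proj₁ (remQuot {m} n i) ; s = λ i → proj₂ (remQuot {m} n i) in
                     Constant (q x) (q y) (q z) (q w) → Constant (s x) (s y) (s z) (s w) → Constant x y z w
  constant-remQuot {m} n (p₁ , p₂ , p₃) (q₁ , q₂ , q₃) =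
    inj p₁ q₁ , inj p₂ q₂ , inj p₃ q₃
    where
    inj : ∀ {i j} → proj₁ (remQuot {m} n i) ≡ proj₁ (remQuot {m} n j) →
          proj₂ (remQuot {m} n i) ≡ proj₂ (remQuot {m} n j) → i ≡ j
    inj p q = remQuot-injective n (cong₂ _,_ p q)

  pointwise? : ∀ {A : Set} {R : A → A → A → A → Set} → (∀ x y z w → Dec (R x y z w)) →
               ∀ {n} (xs ys zs ws : Vec A n) → Dec (Pointwise₄ R xs ys zs ws)
  pointwise? R? [] [] [] [] = yes []
  pointwise? R? (x ∷ xs) (y ∷ ys) (z ∷ zs) (w ∷ ws) =
    map′ (λ (r , p) → r ∷ p) (λ { (r ∷ p) → r , p }) (R? x y z w ×-dec pointwise? R? xs ys zs ws)

  solution₅? : ∀ x y z w → Dec (Solution₅ x y z w)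
  solution₅? x y z w = (3 * x + y) % 5 ≟ (2 * (z + w)) % 5

  -- Words over a weighted alphabet

  module Words {b c : ℕ} (digits : Fin b → Vec ℕ c) (weight : Fin b → ℕ) where

    word : ∀ n → Fin (b ^ n) → Vec ℕ (n * c)
    word zero    _ = []
    word (suc n) i = let a , j = remQuot (b ^ n) i in digits a ++ word n j

    total : ∀ n → Fin (b ^ n) → ℕ
    total zero    _ = 0
    total (suc n) i = let a , j = remQuot (b ^ n) i in weight a + total n j

    word-All : ∀ {P : ℕ → Set} → (∀ a → All P (digits a)) → ∀ n i → All P (word n i)
    word-All p zero    _ = []
    word-All p (suc n) i = let a , j = remQuot (b ^ n) i in ++⁺ (p a) (word-All p n j)

    total-≤ : ∀ {K} → (∀ a → weight a ≤ K) → ∀ n i → total n i ≤ n * K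
    total-≤ p zero    _ = z≤n
    total-≤ p (suc n) i = +-mono-≤ (p _) (total-≤ p n _)

    -- A strict convexity: modulo 5 a solution makes y the mean of x, z and w, and the weight at the
    -- mean is less than the mean of the weights unless the solution is constant.
    Convex : Set
    Convex = ∀ x y z w → Pointwise₄ Solution₅ (digits x) (digits y) (digits z) (digits w) →
             3 * weight y < weight x + weight z + weight w ⊎ Constant x y z w

    -- The inequalities add up over the letters. A constant letter contributes an equality, so a
    -- single non-constant letter already makes the sum strict.
    total-convex : Convex → ∀ n x y z w → Pointwise₄ Solution₅ (word n x) (word n y) (word n z) (word n w) →
                   3 * total n y < total n x + total n z + total n w ⊎ Constant x y z w
    total-convex convex zero zero zero zero zero _ = inj₂ (refl , refl , refl)
    total-convex convex (suc n) x y z w p = merge (convex _ _ _ _ (proj₁ split)) (total-convex convex n _ _ _ _ (proj₂ split))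
      where
      open +-*-Solver
      q : Fin (b ^ suc n) → Fin b
      q i = proj₁ (remQuot (b ^ n) i)
      t : Fin (b ^ suc n) → Fin (b ^ n)
      t i = proj₂ (remQuot {b} (b ^ n) i)
      split = ++⁻ (digits (q x)) (digits (q y)) (digits (q z)) (digits (q w)) p
      constant-≤ : ∀ {A : Set} (f : A → ℕ) {x y z w} → Constant x y z w → 3 * f y ≤ f x + f z + f w
      constant-≤ f {x} (refl , refl , refl) = ≤-reflexive (solve 1 (λ a → con 3 :* a := a :+ a :+ a) refl (f x))
      strict : 3 * weight (q y) + 3 * total n (t y) <
               (weight (q x) + weight (q z) + weight (q w)) + (total n (t x) + total n (t z) + total n (t w)) →
               3 * total (suc n) y < total (suc n) x + total (suc n) z + total (suc n) w
      strict = subst₂ _<_ (sym (*-distribˡ-+ 3 (weight (q y)) (total n (t y))))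
        (solve 6 (λ a b c d e f → (a :+ b :+ c) :+ (d :+ e :+ f) := (a :+ d) :+ (b :+ e) :+ (c :+ f)) refl
          (weight (q x)) (weight (q z)) (weight (q w)) (total n (t x)) (total n (t z)) (total n (t w)))
      merge : 3 * weight (q y) < weight (q x) + weight (q z) + weight (q w) ⊎ Constant (q x) (q y) (q z) (q w) →
              3 * total n (t y) < total n (t x) + total n (t z) + total n (t w) ⊎ Constant (t x) (t y) (t z) (t w) →
              3 * total (suc n) y < total (suc n) x + total (suc n) z + total (suc n) w ⊎ Constant x y z w
      merge (inj₁ p) (inj₁ p′) = inj₁ (strict (+-mono-< p p′))
      merge (inj₁ p) (inj₂ c′) = inj₁ (strict (+-mono-<-≤ p (constant-≤ (total n) c′)))
      merge (inj₂ c) (inj₁ p′) = inj₁ (strict (+-mono-≤-< (constant-≤ weight c) p′))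
      merge (inj₂ c) (inj₂ c′) = inj₂ (constant-remQuot (b ^ n) c c′)

    -- When all totals equal t, the strict inequality would read 3t < 3t, so only the constant
    -- alternative of `total-convex` remains.
    fibre-rigid : Convex → ∀ n {s} (e : Fin s → Fin (b ^ n)) → Injective _≡_ _≡_ e → ∀ t → (∀ a → total n (e a) ≡ t) →
                  ∀ x y z w → Pointwise₄ Solution₅ (word n (e x)) (word n (e y)) (word n (e z)) (word n (e w)) → Constant x y z w
    fibre-rigid convex n e e-injective t total≡t x y z w p with total-convex convex n (e x) (e y) (e z) (e w) p
    ... | inj₂ (p₁ , p₂ , p₃) = e-injective p₁ , e-injective p₂ , e-injective p₃
    ... | inj₁ lt rewrite total≡t x | total≡t y | total≡t z | total≡t w =
      contradiction lt (≤⇒≯ (≤-reflexive (solve 1 (λ t → t :+ t :+ t := con 3 :* t) refl t)))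
      where open +-*-Solver

  -- Pigeonhole principle

  unique-lookup-injective : ∀ {A : Set} {xs : List A} → Unique xs → Injective _≡_ _≡_ (List.lookup xs)
  unique-lookup-injective (x∉ ∷ u) {zero}  {zero}  eq = refl
  unique-lookup-injective (x∉ ∷ u) {zero}  {suc j} eq = contradiction eq (ListAll.lookup x∉ (∈-lookup j))
  unique-lookup-injective (x∉ ∷ u) {suc i} {zero}  eq = contradiction (sym eq) (ListAll.lookup x∉ (∈-lookup i))
  unique-lookup-injective (x∉ ∷ u) {suc i} {suc j} eq = cong suc (unique-lookup-injective u eq)

  module _ {A : Set} {P : Pred A 0ℓ} (P? : Decidable P) where

    length-filter+∁ : ∀ xs → length xs ≡ length (filter P? xs) + length (filter (∁? P?) xs)
    length-filter+∁ List.[] = refl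
    length-filter+∁ (x List.∷ xs) with P? x
    ... | yes _ = cong suc (length-filter+∁ xs)
    ... | no  _ = trans (cong suc (length-filter+∁ xs)) (sym (+-suc _ _))

    length-filter-filter : ∀ {Q : Pred A 0ℓ} (Q? : Decidable Q) xs →
                           length (filter P? (filter Q? xs)) ≤ length (filter P? xs)
    length-filter-filter Q? List.[] = z≤n
    length-filter-filter Q? (x List.∷ xs) with Q? x
    length-filter-filter Q? (x List.∷ xs) | yes _ with P? x
    ... | yes _ = s≤s (length-filter-filter Q? xs)
    ... | no  _ = length-filter-filter Q? xs
    length-filter-filter Q? (x List.∷ xs) | no _ with P? x
    ... | yes _ = m≤n⇒m≤1+n (length-filter-filter Q? xs)
    ... | no  _ = length-filter-filter Q? xs

  module _ {A : Set} (f : A → ℕ) where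

    fibre : ℕ → List A → List A
    fibre t = filter (λ x → f x ≟ t)

    rest : ℕ → List A → List A
    rest t = filter (∁? (λ x → f x ≟ t))

    rest-< : ∀ {T} xs → ListAll.All (λ x → f x < suc T) xs → ListAll.All (λ x → f x < T) (rest T xs)
    rest-< {T} xs p = ListAll.zipWith (λ (fx< , ≢) → ≤∧≢⇒< (≤-pred fx<) ≢)
      (all-filter⁺ (∁? (λ x → f x ≟ T)) p , all-filter (∁? (λ x → f x ≟ T)) xs)

    -- Induction on the number of possible values: the fibre of the largest value is split off, and
    -- the larger of it and the best fibre found in the rest is kept.
    pigeonhole : ∀ T xs → ListAll.All (λ x → f x < T) xs → ∃ λ t → length xs ≤ T * length (fibre t xs)
    pigeonhole zero List.[] _ = 0 , z≤n
    pigeonhole zero (x List.∷ xs) (() ListAll.∷ _)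
    pigeonhole (suc T) xs p with pigeonhole T (rest T xs) (rest-< xs p)
    ... | t , le = choose (≤-total (length (fibre T xs)) (length (fibre t xs)))
      where
      open ≤-Reasoning
      bound : length xs ≤ length (fibre T xs) + T * length (fibre t xs)
      bound = begin
        length xs                                  ≡⟨ length-filter+∁ (λ x → f x ≟ T) xs ⟩
        length (fibre T xs) + length (rest T xs) ≤⟨ +-monoʳ-≤ _ le ⟩
        length (fibre T xs) + T * _ ≤⟨ +-monoʳ-≤ (length (fibre T xs)) (*-monoʳ-≤ T (length-filter-filter (λ x → f x ≟ t) (∁? (λ x → f x ≟ T)) xs)) ⟩
        length (fibre T xs) + T * length (fibre t xs) ∎
      choose : length (fibre T xs) ≤ length (fibre t xs) ⊎ length (fibre t xs) ≤ length (fibre T xs) →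
               ∃ λ t → length xs ≤ suc T * length (fibre t xs)
      choose (inj₁ le′) = t , ≤-trans bound (+-monoˡ-≤ _ le′)
      choose (inj₂ le′) = T , ≤-trans bound (+-monoʳ-≤ (length (fibre T xs)) (*-monoʳ-≤ T le′))

  -- The fibre is enumerated by its list of elements, and this enumeration is injective because
  -- `allFin M` has no repetitions.
  large-fibre : ∀ {M T} (f : Fin M → ℕ) → (∀ i → f i < T) →
                ∃ λ s → M ≤ T * s × ∃ λ (e : Fin s → Fin M) → Injective _≡_ _≡_ e × ∃ λ t → ∀ a → f (e a) ≡ t
  large-fibre {M} {T} f f< with pigeonhole f T (allFin M) (ListAll.universal f< (allFin M))
  ... | t , le = length (fibre f t (allFin M))
               , subst (_≤ T * length (fibre f t (allFin M))) (length-tabulate {n = M} (λ i → i)) le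
               , List.lookup (fibre f t (allFin M))
               , unique-lookup-injective (filter⁺ (λ x → f x ≟ t) (allFin⁺ M))
               , t
               , λ a → ListAll.lookup (all-filter (λ x → f x ≟ t) (allFin M)) (∈-lookup a)

  -- Vectors with base 5 digits

  infixl 6 _⊞_

  -- Gives each coordinate of the second vector a new lowest base 5 digit, taken from the first.
  _⊞_ : ∀ {n} → Vec ℕ n → Vec ℕ n → Vec ℕ n
  _⊞_ = zipWith (λ d e → d + 5 * e)

  module Levels {s m : ℕ} (digits : Fin s → Vec ℕ m) (digits< : ∀ a → All (_< 5) (digits a))
    (rigid₅ : ∀ x y z w → Pointwise₄ Solution₅ (digits x) (digits y) (digits z) (digits w) → Constant x y z w) where

    level : ∀ k → Fin (s ^ k) → Vec ℕ m
    level zero    _ = replicate m 0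
    level (suc k) i = let a , j = remQuot (s ^ k) i in digits a ⊞ level k j

    level< : ∀ k i → All (_< 5 ^ k) (level k i)
    level< zero    _ = zeros m
      where
      zeros : ∀ n → All (_< 1) (replicate n 0)
      zeros zero    = []
      zeros (suc n) = s≤s z≤n ∷ zeros n
    level< (suc k) i = zips (digits< _) (level< k _)
      where
      digit+5 : ∀ {d e q} → d < 5 → e < q → d + 5 * e < 5 * q
      digit+5 {d} {e} {q} d<5 e<q = begin-strict
        d + 5 * e <⟨ +-monoˡ-< (5 * e) d<5 ⟩
        5 + 5 * e ≡⟨ sym (*-suc 5 e) ⟩
        5 * suc e ≤⟨ *-monoʳ-≤ 5 e<q ⟩
        5 * q ∎
        where open ≤-Reasoning
      zips : ∀ {n q} {ds es : Vec ℕ n} → All (_< 5) ds → All (_< q) es → All (_< 5 * q) (ds ⊞ es)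
      zips [] [] = []
      zips (d< ∷ ds<) (e< ∷ es<) = digit+5 d< e< ∷ zips ds< es<

    mod₅ : ∀ x y z w x′ y′ z′ w′ → Solution (x + 5 * x′) (y + 5 * y′) (z + 5 * z′) (w + 5 * w′) → Solution₅ x y z w
    mod₅ x y z w x′ y′ z′ w′ eq = begin
      (3 * x + y) % 5                              ≡⟨ sym ([m+kn]%n≡m%n (3 * x + y) (3 * x′ + y′) 5) ⟩
      ((3 * x + y) + (3 * x′ + y′) * 5) % 5        ≡⟨ cong (_% 5) (trans (sym (shiftˡ 5 x y x′ y′)) (trans eq (shiftʳ 5 z w z′ w′))) ⟩
      (2 * (z + w) + 2 * (z′ + w′) * 5) % 5      ≡⟨ [m+kn]%n≡m%n (2 * (z + w)) (2 * (z′ + w′)) 5 ⟩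
      (2 * (z + w)) % 5                            ∎
      where open ≡-Reasoning

    low : ∀ {n} (xs ys zs ws : Vec ℕ n) {xs′ ys′ zs′ ws′ : Vec ℕ n} →
          Pointwise₄ Solution (xs ⊞ xs′) (ys ⊞ ys′) (zs ⊞ zs′) (ws ⊞ ws′) → Pointwise₄ Solution₅ xs ys zs ws
    low [] [] [] [] _ = []
    low (x ∷ xs) (y ∷ ys) (z ∷ zs) (w ∷ ws) {x′ ∷ _} {y′ ∷ _} {z′ ∷ _} {w′ ∷ _} (p ∷ ps) =
      mod₅ x y z w x′ y′ z′ w′ p ∷ low xs ys zs ws ps

    -- A common lowest digit d solves the equation by itself, so its share 4d cancels from both
    -- sides without a carry, and what remains is divisible by 5.
    high : ∀ {n} (ds : Vec ℕ n) {xs ys zs ws : Vec ℕ n} →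
           Pointwise₄ Solution (ds ⊞ xs) (ds ⊞ ys) (ds ⊞ zs) (ds ⊞ ws) → Pointwise₄ Solution xs ys zs ws
    high [] {[]} {[]} {[]} {[]} [] = []
    high (d ∷ ds) {x ∷ _} {y ∷ _} {z ∷ _} {w ∷ _} (p ∷ ps) = *-cancelʳ-≡ (3 * x + y) (2 * (z + w)) 5
      (+-cancelˡ-≡ (3 * d + d) _ _ (trans (sym (shiftˡ 5 d d x y)) (trans p
        (trans (shiftʳ 5 d d z w) (cong (_+ 2 * (z + w) * 5) (sym (solution-constant d))))))) ∷ high ds ps

    level-rigid : ∀ k x y z w → Pointwise₄ Solution (level k x) (level k y) (level k z) (level k w) → Constant x y z w
    level-rigid zero zero zero zero zero _ = refl , refl , refl
    level-rigid (suc k) x y z w p = constant-remQuot (s ^ k) same (level-rigid k _ _ _ _ (strip same p))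
      where
      q : Fin (s ^ suc k) → Fin s
      q i = proj₁ (remQuot (s ^ k) i)
      same : Constant (q x) (q y) (q z) (q w)
      same = rigid₅ _ _ _ _ (low (digits (q x)) (digits (q y)) (digits (q z)) (digits (q w)) p)
      strip : ∀ {a b c d} {xs ys zs ws} → Constant a b c d →
             Pointwise₄ Solution (digits a ⊞ xs) (digits b ⊞ ys) (digits c ⊞ zs) (digits d ⊞ ws) → Pointwise₄ Solution xs ys zs ws
      strip {a} (refl , refl , refl) = high (digits a)

  -- Packing a vector into one integer

  module Pack (q : ℕ) .{{_ : NonZero q}} where

    -- Each side of the equation has coefficient sum 4, so for entries below q both sides stay below
    -- 4q and no carry occurs in base B.
    B : ℕ
    B = 4 * q

    pack : ∀ {m} → Vec ℕ m → ℕ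
    pack []       = 0
    pack (x ∷ xs) = x + B * pack xs

    pack< : ∀ {m} {xs : Vec ℕ m} → All (_< q) xs → pack xs < B ^ m
    pack< [] = s≤s z≤n
    pack< {suc m} {x ∷ xs} (x<q ∷ p) = begin-strict
      x + B * pack xs  <⟨ +-monoˡ-< (B * pack xs) (<-≤-trans x<q (m≤m+n q (3 * q))) ⟩
      B + B * pack xs  ≡⟨ sym (*-suc B (pack xs)) ⟩
      B * suc (pack xs) ≤⟨ *-monoʳ-≤ B (pack< p) ⟩
      B * B ^ m ∎
      where open ≤-Reasoning

    instance
      B≢0 : NonZero B
      B≢0 = m*n≢0 4 q

    division-unique : ∀ {a c} a′ c′ → a < B → c < B → a + a′ * B ≡ c + c′ * B → a ≡ c × a′ ≡ c′
    division-unique {a} {c} a′ c′ a<B c<B eq = a≡c , *-cancelʳ-≡ a′ c′ B (+-cancelˡ-≡ a _ _ (trans eq (cong (_+ c′ * B) (sym a≡c))))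
      where
      open ≡-Reasoning
      a≡c : a ≡ c
      a≡c = begin
        a                 ≡⟨ sym (m<n⇒m%n≡m a<B) ⟩
        a % B             ≡⟨ sym ([m+kn]%n≡m%n a a′ B) ⟩
        (a + a′ * B) % B  ≡⟨ cong (_% B) eq ⟩
        (c + c′ * B) % B  ≡⟨ [m+kn]%n≡m%n c c′ B ⟩
        c % B             ≡⟨ m<n⇒m%n≡m c<B ⟩
        c                 ∎

    unpack : ∀ {m} {xs ys zs ws : Vec ℕ m} → All (_< q) xs → All (_< q) ys → All (_< q) zs → All (_< q) ws →
             Solution (pack xs) (pack ys) (pack zs) (pack ws) → Pointwise₄ Solution xs ys zs ws
    unpack [] [] [] [] _ = []
    unpack {_} {x ∷ xs} {y ∷ ys} {z ∷ zs} {w ∷ ws} (x< ∷ xs<) (y< ∷ ys<) (z< ∷ zs<) (w< ∷ ws<) eq =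
      let p , p′ = division-unique (3 * pack xs + pack ys) (2 * (pack zs + pack ws)) left right
                     (trans (sym (shiftˡ B x y (pack xs) (pack ys))) (trans eq (shiftʳ B z w (pack zs) (pack ws))))
      in p ∷ unpack xs< ys< zs< ws< p′
      where
      open ≤-Reasoning
      open +-*-Solver
      left : 3 * x + y < B
      left = begin-strict
        3 * x + y <⟨ +-mono-≤-< (*-monoʳ-≤ 3 (<⇒≤ x<)) y< ⟩
        3 * q + q ≡⟨ solve 1 (λ q → con 3 :* q :+ q := con 4 :* q) refl q ⟩
        B ∎
      right : 2 * (z + w) < B
      right = begin-strict
        2 * (z + w) <⟨ *-monoʳ-< 2 (+-mono-< z< w<) ⟩
        2 * (q + q) ≡⟨ solve 1 (λ q → con 2 :* (q :+ q) := con 4 :* q) refl q ⟩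
        B ∎

  -- From rigid maps to L₃-free sets

  image : ∀ {M N} → (Fin M → Fin N) → Subset N
  image {zero}  f = ⊥
  image {suc M} f = image (f ∘ suc) [ f zero ]≔ inside

  ∈-image⁻ : ∀ {M N} (f : Fin M → Fin N) {i} → i ∈ image f → ∃ λ a → f a ≡ i
  ∈-image⁻ {zero}  f i∈ = contradiction i∈ ∉⊥
  ∈-image⁻ {suc M} f {i} i∈ with i ≟ᶠ f zero
  ... | yes i≡ = zero , sym i≡
  ... | no  i≢ = let a , eq = ∈-image⁻ (f ∘ suc) (lookup⇒[]= i _ (trans (sym (lookup∘update′ i≢ (image (f ∘ suc)) inside)) ([]=⇒lookup i∈)))
                 in suc a , eq

  ∣insert∣ : ∀ {N} (p : Subset N) i → i ∉ p → ∣ p [ i ]≔ inside ∣ ≡ suc ∣ p ∣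
  ∣insert∣ (inside  ∷ p) zero    i∉ = contradiction here i∉
  ∣insert∣ (outside ∷ p) zero    i∉ = refl
  ∣insert∣ (inside  ∷ p) (suc i) i∉ = cong suc (∣insert∣ p i (i∉ ∘ there))
  ∣insert∣ (outside ∷ p) (suc i) i∉ = ∣insert∣ p i (i∉ ∘ there)

  ∣image∣ : ∀ {M N} (f : Fin M → Fin N) → Injective _≡_ _≡_ f → ∣ image f ∣ ≡ M
  ∣image∣ {zero}  {N} f inj = ∣⊥∣≡0 N
  ∣image∣ {suc M} f inj = trans (∣insert∣ (image (f ∘ suc)) (f zero) fresh) (cong suc (∣image∣ (f ∘ suc) λ eq → suc-injectiveᶠ (inj eq)))
    where
    fresh : f zero ∉ image (f ∘ suc)
    fresh f0∈ with ∈-image⁻ (f ∘ suc) f0∈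
    ... | a , eq with inj eq
    ... | ()

  evaluate⇒Solution : ∀ x y z w → evaluate L₃ (+ x ∷ + y ∷ + z ∷ + w ∷ []) ≡ 0ℤ → Solution x y z w
  evaluate⇒Solution x y z w eq = ℤ.+-injective (begin
    + (3 * x + y)                  ≡⟨ ℤ.pos-+ (3 * x) y ⟩
    + (3 * x) ℤ.+ + y              ≡⟨ cong (ℤ._+ + y) (ℤ.pos-* 3 x) ⟩
    + 3 ℤ.* + x ℤ.+ + y            ≡⟨ rearrange (+ x) (+ y) (+ z) (+ w) ⟩
    evaluate L₃ (+ x ∷ + y ∷ + z ∷ + w ∷ []) ℤ.+ + 2 ℤ.* (+ z ℤ.+ + w) ≡⟨ cong (ℤ._+ + 2 ℤ.* (+ z ℤ.+ + w)) eq ⟩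
    0ℤ ℤ.+ + 2 ℤ.* (+ z ℤ.+ + w)   ≡⟨ ℤ.+-identityˡ _ ⟩
    + 2 ℤ.* (+ z ℤ.+ + w)          ≡⟨ sym (ℤ.pos-* 2 (z + w)) ⟩
    + (2 * (z + w))                ∎)
    where
    open ≡-Reasoning
    open ℤ-Solver
    -- The nested sum ending in `0ℤ` is what `evaluate L₃` computes to.
    rearrange : ∀ x y z w → + 3 ℤ.* x ℤ.+ y ≡
      (+ 3 ℤ.* x ℤ.+ (+ 1 ℤ.* y ℤ.+ (-[1+ 1 ] ℤ.* z ℤ.+ (-[1+ 1 ] ℤ.* w ℤ.+ 0ℤ)))) ℤ.+ + 2 ℤ.* (z ℤ.+ w)
    rearrange = solve 4 (λ x y z w → con (+ 3) :* x :+ y :=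
      (con (+ 3) :* x :+ (con (+ 1) :* y :+ (con -[1+ 1 ] :* z :+ (con -[1+ 1 ] :* w :+ con 0ℤ)))) :+ con (+ 2) :* (z :+ w)) refl

  -- Translation preserves solutions because the coefficients sum to zero. This removes the offset
  -- by which `i : Fin N` stands for i + 1.
  Solution-pred : ∀ {x y z w} → Solution (suc x) (suc y) (suc z) (suc w) → Solution x y z w
  Solution-pred {x} {y} {z} {w} eq = +-cancelˡ-≡ 4 _ _ (trans (sym (left x y)) (trans eq (right z w)))
    where
    open +-*-Solver
    left : ∀ x y → 3 * suc x + suc y ≡ 4 + (3 * x + y)
    left = solve 2 (λ x y → con 3 :* (con 1 :+ x) :+ (con 1 :+ y) := con 4 :+ (con 3 :* x :+ y)) refl
    right : ∀ z w → 2 * (suc z + suc w) ≡ 4 + 2 * (z + w)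
    right = solve 2 (λ z w → con 2 :* (con 1 :+ z :+ (con 1 :+ w)) := con 4 :+ con 2 :* (z :+ w)) refl

  -- All indices form one block, and the four coefficients sum to zero.
  constant-trivial : ∀ v → Trivial L₃ (v ∷ v ∷ v ∷ v ∷ [])
  constant-trivial v i rewrite lookup-replicate i v | dec-true (v ℤ.≟ v) refl = refl

  rigid⇒≤r : ∀ {M N} (e : Fin M → ℕ) → (∀ a → e a < N) → Rigid e → M ≤ r L₃ N
  rigid⇒≤r {M} {N} e e<N rigid = subst (_≤ r L₃ N) (∣image∣ f f-injective) (r-upper L₃ (image f) free)
    where
    f : Fin M → Fin N
    f a = fromℕ< (e<N a)
    f-injective : Injective _≡_ _≡_ f
    -- If `e a` and `e b` agree, then (a, b, a, a) is a solution, and rigidity identifies a with b.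
    f-injective {a} {b} fa≡fb = proj₁ (rigid a b a a (subst (λ t → 3 * e a + t ≡ 2 * (e a + e a)) ea≡eb (solution-constant (e a))))
      where
      ea≡eb : e a ≡ e b
      ea≡eb = trans (sym (toℕ-fromℕ< (e<N a))) (trans (cong toℕ fa≡fb) (toℕ-fromℕ< (e<N b)))
    element : ∀ {v} → ⟦ image f ⟧ v → ∃ λ a → v ≡ + suc (e a)
    element (i , i∈ , refl) = let a , eq = ∈-image⁻ f i∈ in
      a , cong (λ j → + suc j) (trans (cong toℕ (sym eq)) (toℕ-fromℕ< (e<N a)))
    free : Free L₃ ⟦ image f ⟧
    free (x ∷ y ∷ z ∷ w ∷ []) (x∈ ∷ y∈ ∷ z∈ ∷ w∈ ∷ []) eq = go (element x∈) (element y∈) (element z∈) (element w∈) eq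
      where
      go : ∀ {x y z w} → (∃ λ a → x ≡ + suc (e a)) → (∃ λ a → y ≡ + suc (e a)) →
           (∃ λ a → z ≡ + suc (e a)) → (∃ λ a → w ≡ + suc (e a)) →
           evaluate L₃ (x ∷ y ∷ z ∷ w ∷ []) ≡ 0ℤ → Trivial L₃ (x ∷ y ∷ z ∷ w ∷ [])
      go (a , refl) (b , refl) (c , refl) (d , refl) eq
        with rigid a b c d (Solution-pred (evaluate⇒Solution (suc (e a)) (suc (e b)) (suc (e c)) (suc (e d)) eq))
      ... | refl , refl , refl = constant-trivial (+ suc (e a))

  r≥1 : ∀ N .{{_ : NonZero N}} → 1 ≤ r L₃ N
  r≥1 N = rigid⇒≤r {1} (λ _ → 0) (λ _ → >-nonZero⁻¹ N) λ { zero zero zero zero _ → refl , refl , refl }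

  -- A total lies between 0 and nK, whence the factor nK + 1 lost to the pigeonhole principle. The
  -- size s depends on n alone, so k and N may vary after n is fixed.
  convex⇒free-sets : ∀ {b c K} (digits : Fin b → Vec ℕ c) (weight : Fin b → ℕ) → Words.Convex digits weight →
    (∀ a → All (_< 5) (digits a)) → (∀ a → weight a ≤ K) →
    ∀ n → ∃ λ s → b ^ n ≤ suc (n * K) * s × (∀ k N → (4 * 5 ^ k) ^ (n * c) ≤ N → s ^ k ≤ r L₃ N)
  convex⇒free-sets {b} {c} {K} digits weight convex digits< weight≤ n =
    from (large-fibre (total n) (λ i → s≤s (total-≤ weight≤ n i)))
    where
    open Words digits weight
    from : (∃ λ s → b ^ n ≤ suc (n * K) * s × ∃ λ (e : Fin s → Fin (b ^ n)) → Injective _≡_ _≡_ e × ∃ λ t → ∀ a → total n (e a) ≡ t) →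
           ∃ λ s → b ^ n ≤ suc (n * K) * s × (∀ k N → (4 * 5 ^ k) ^ (n * c) ≤ N → s ^ k ≤ r L₃ N)
    from (s , bⁿ≤ , e , e-injective , t , total≡t) = s , bⁿ≤ , λ k N le →
      let open Pack (5 ^ k) {{m^n≢0 5 k}} in
      rigid⇒≤r (λ i → pack (level k i)) (λ i → <-≤-trans (pack< (level< k i)) le)
        (λ x y z w eq → level-rigid k x y z w (unpack (level< k x) (level< k y) (level< k z) (level< k w) eq))
      where
      open Levels (λ a → word n (e a)) (λ a → word-All digits< n (e a)) (fibre-rigid convex n e e-injective t total≡t)

  -- The 15 weighted points of 𝔽₅³

  -- Points and weights were found by a computer search (local search with linear programming).
  points : Vec (Vec ℕ 3) 15
  points = (1 ∷ 4 ∷ 2 ∷ []) ∷ (4 ∷ 3 ∷ 3 ∷ []) ∷ (0 ∷ 3 ∷ 4 ∷ []) ∷ (1 ∷ 2 ∷ 3 ∷ []) ∷ (4 ∷ 1 ∷ 4 ∷ [])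
         ∷ (0 ∷ 0 ∷ 4 ∷ []) ∷ (2 ∷ 3 ∷ 2 ∷ []) ∷ (1 ∷ 2 ∷ 2 ∷ []) ∷ (2 ∷ 1 ∷ 3 ∷ []) ∷ (4 ∷ 0 ∷ 1 ∷ [])
         ∷ (4 ∷ 0 ∷ 3 ∷ []) ∷ (4 ∷ 3 ∷ 4 ∷ []) ∷ (1 ∷ 4 ∷ 0 ∷ []) ∷ (0 ∷ 3 ∷ 2 ∷ []) ∷ (2 ∷ 0 ∷ 4 ∷ []) ∷ []

  weights : Vec ℕ 15
  weights = 0 ∷ 0 ∷ 1 ∷ 1 ∷ 1 ∷ 2 ∷ 2 ∷ 3 ∷ 3 ∷ 3 ∷ 7 ∷ 8 ∷ 23 ∷ 61 ∷ 183 ∷ []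

  -- Decided by evaluation over all 15⁴ quadruples of points.
  convex : Words.Convex (lookup points) (lookup weights)
  convex = from-yes (all? λ x → all? λ y → all? λ z → all? λ w →
    pointwise? solution₅? (lookup points x) (lookup points y) (lookup points z) (lookup points w) →-dec
    ((3 * lookup weights y <? lookup weights x + lookup weights z + lookup weights w) ⊎-dec
     ((x ≟ᶠ y) ×-dec (x ≟ᶠ z) ×-dec (x ≟ᶠ w))))

  points<5 : ∀ a → All (_< 5) (lookup points a)
  points<5 = from-yes (all? λ a → All.all? (_<? 5) (lookup points a))

  weights≤ : ∀ a → lookup weights a ≤ 183
  weights≤ = from-yes (all? λ a → lookup weights a ≤? 183)

  free-sets : ∀ n → ∃ λ s → 15 ^ n ≤ suc (n * 183) * s × (∀ k N → (4 * 5 ^ k) ^ (n * 3) ≤ N → s ^ k ≤ r L₃ N)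
  free-sets = convex⇒free-sets (lookup points) (lookup weights) convex points<5 weights≤

  -- Growth estimates and the bound for rational exponents

  ^-exchange : ∀ x m n → (x ^ m) ^ n ≡ (x ^ n) ^ m
  ^-exchange x m n = trans (^-*-assoc x m n) (trans (cong (x ^_) (*-comm m n)) (sym (^-*-assoc x n m)))

  ^-distribʳ-* : ∀ x y n → (x * y) ^ n ≡ x ^ n * y ^ n
  ^-distribʳ-* x y zero    = refl
  ^-distribʳ-* x y (suc n) = trans (cong (x * y *_) (^-distribʳ-* x y n))
    (solve 4 (λ x y a b → x :* y :* (a :* b) := x :* a :* (y :* b)) refl x y (x ^ n) (y ^ n))
    where open +-*-Solver

  -- Bernoulli's inequality for (1 + 1/P)ᵏ, multiplied by P Pᵏ.
  bernoulli-ℕ : ∀ P k → P ^ k * (P + k) ≤ P * suc P ^ k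
  bernoulli-ℕ P zero    = ≤-reflexive (solve 1 (λ P → con 1 :* (P :+ con 0) := P :* con 1) refl P)
    where open +-*-Solver
  bernoulli-ℕ P (suc k) = begin
    P * P ^ k * (P + suc k)               ≡⟨ cong (P * P ^ k *_) (+-suc P k) ⟩
    P * P ^ k * suc (P + k)               ≡⟨ solve 3 (λ P Q k → P :* Q :* (con 1 :+ (P :+ k)) := P :* (Q :* (P :+ k)) :+ P :* Q) refl P (P ^ k) k ⟩
    P * (P ^ k * (P + k)) + P * P ^ k     ≤⟨ +-monoʳ-≤ (P * (P ^ k * (P + k))) (begin
       P * P ^ k            ≡⟨ *-comm P (P ^ k) ⟩
       P ^ k * P            ≤⟨ *-monoʳ-≤ (P ^ k) (m≤m+n P k) ⟩
       P ^ k * (P + k)      ∎) ⟩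
    P * (P ^ k * (P + k)) + P ^ k * (P + k) ≡⟨ +-comm (P * (P ^ k * (P + k))) _ ⟩
    suc P * (P ^ k * (P + k))             ≤⟨ *-monoʳ-≤ (suc P) (bernoulli-ℕ P k) ⟩
    suc P * (P * suc P ^ k)               ≡⟨ solve 2 (λ P Q → (con 1 :+ P) :* (P :* Q) := P :* ((con 1 :+ P) :* Q)) refl P (suc P ^ k) ⟩
    P * (suc P * suc P ^ k)               ∎
    where
    open ≤-Reasoning
    open +-*-Solver

  -- As Q ≥ P + 1, Bernoulli's inequality bounds (Q/P)ᵏ below by 1 + k/P, and k/P ≥ C. The threshold
  -- for k is explicit because it serves as `k₀` below.
  exponential-dominates-constant : ∀ C {P Q} .{{_ : NonZero P}} → P < Q → ∀ k → C * P ≤ k → C * P ^ k ≤ Q ^ k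
  exponential-dominates-constant C {P} {Q} P<Q k CP≤k = *-cancelˡ-≤ P (begin
    P * (C * P ^ k)      ≡⟨ solve 3 (λ P C R → P :* (C :* R) := R :* (C :* P)) refl P C (P ^ k) ⟩
    P ^ k * (C * P)      ≤⟨ *-monoʳ-≤ (P ^ k) (≤-trans CP≤k (m≤n+m k P)) ⟩
    P ^ k * (P + k)      ≤⟨ bernoulli-ℕ P k ⟩
    P * suc P ^ k        ≤⟨ *-monoʳ-≤ P (^-monoˡ-≤ k P<Q) ⟩
    P * Q ^ k            ∎)
    where
    open ≤-Reasoning
    open +-*-Solver

  -- Squaring Bernoulli's inequality makes the linear term win at j = 2i, i = 2cP² + 1.
  exponential-dominates-linear : ∀ c {P Q} .{{_ : NonZero P}} → P < Q → ∃ λ j → suc (suc j * c) * P ^ suc j < Q ^ suc j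
  exponential-dominates-linear c {P} {Q} P<Q = 2i-1 , (begin-strict
    suc (suc 2i-1 * c) * P ^ suc 2i-1   ≡⟨ cong (λ j → suc (j * c) * P ^ j) 2i≡ ⟩
    suc ((i + i) * c) * P ^ (i + i)     ≡⟨ cong (suc ((i + i) * c) *_) (^-distribˡ-+-* P i i) ⟩
    suc ((i + i) * c) * (R * R)         <⟨ *-cancelˡ-< (P * P) _ _ main ⟩
    S * S                               ≤⟨ *-mono-≤ S≤ S≤ ⟩
    Q ^ i * Q ^ i                       ≡⟨ sym (^-distribˡ-+-* Q i i) ⟩
    Q ^ (i + i)                         ≡⟨ cong (Q ^_) (sym 2i≡) ⟩
    Q ^ suc 2i-1                        ∎)
    where
    open ≤-Reasoning
    open +-*-Solver
    i-1 i 2i-1 R S : ℕ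
    i-1 = 2 * c * (P * P)
    i = suc i-1
    2i-1 = i-1 + i
    R = P ^ i
    S = suc P ^ i
    2i≡ : suc 2i-1 ≡ i + i
    2i≡ = refl
    S≤ : S ≤ Q ^ i
    S≤ = ^-monoˡ-≤ i P<Q
    instance
      R≢0 : NonZero (R * R)
      R≢0 = m*n≢0 R R {{m^n≢0 P i}} {{m^n≢0 P i}}
    square : P * P * suc ((i + i) * c) < (P + i) * (P + i)
    square = begin-strict
      P * P * suc ((i + i) * c)             ≡⟨ solve 3 (λ P i c → P :* P :* (con 1 :+ (i :+ i) :* c) := P :* P :+ i :* (con 2 :* c :* (P :* P))) refl P i c ⟩
      P * P + i * i-1                       <⟨ +-monoʳ-< (P * P) (*-monoʳ-< i (n<1+n i-1)) ⟩
      P * P + i * i                         ≤⟨ m≤m+n _ (2 * P * i) ⟩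
      P * P + i * i + 2 * P * i             ≡⟨ solve 2 (λ P i → P :* P :+ i :* i :+ con 2 :* P :* i := (P :+ i) :* (P :+ i)) refl P i ⟩
      (P + i) * (P + i)                     ∎
    main : P * P * (suc ((i + i) * c) * (R * R)) < P * P * (S * S)
    main = begin-strict
      P * P * (suc ((i + i) * c) * (R * R)) ≡⟨ sym (*-assoc (P * P) _ (R * R)) ⟩
      P * P * suc ((i + i) * c) * (R * R)   <⟨ *-monoˡ-< (R * R) square ⟩
      (P + i) * (P + i) * (R * R)           ≡⟨ solve 2 (λ T R → T :* T :* (R :* R) := (R :* T) :* (R :* T)) refl (P + i) R ⟩
      (R * (P + i)) * (R * (P + i))         ≤⟨ *-mono-≤ (bernoulli-ℕ P i) (bernoulli-ℕ P i) ⟩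
      (P * S) * (P * S)                     ≡⟨ solve 2 (λ P S → (P :* S) :* (P :* S) := P :* P :* (S :* S)) refl P S ⟩
      P * P * (S * S)                       ∎

  -- A linear search upwards from `k₀`. Since `k < g k`, it must have succeeded by the time k
  -- exceeds N.
  between : (g : ℕ → ℕ) → (∀ k → k < g k) → ∀ k₀ N → g k₀ ≤ N → ∃ λ k → k₀ ≤ k × g k ≤ N × N < g (suc k)
  between g k<g k₀ N gk₀≤N = search (suc N) k₀ ≤-refl gk₀≤N (m≤m+n (suc N) k₀)
    where
    search : ∀ d k → k₀ ≤ k → g k ≤ N → suc N ≤ d + k → ∃ λ k → k₀ ≤ k × g k ≤ N × N < g (suc k)
    search zero    k k₀≤k gk≤N N<k = k , k₀≤k , gk≤N , <-trans (<-trans N<k (n<1+n k)) (k<g (suc k))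
    search (suc d) k k₀≤k gk≤N le with N <? g (suc k)
    ... | yes N<g = k , k₀≤k , gk≤N , N<g
    ... | no  N≮g = search d (suc k) (m≤n⇒m≤1+n k₀≤k) (≮⇒≥ N≮g) (subst (suc N ≤_) (sym (+-suc d k)) le)

  -- The exponent u/v is treated through v-th powers. First n is taken so large that the gap between
  -- (5^c)^u and b^v outweighs the pigeonhole loss, which gives `W ^ u < s ^ v`. Then k is taken so
  -- large that this second gap absorbs the constant `C`. Every large N lies between consecutive
  -- values of `g`: the upper one bounds N, the lower one provides the free set.
  polynomial-lower-bound : (R : ℕ → ℕ) {b c K : ℕ} .{{_ : NonZero c}} →
    (∀ n → ∃ λ s → b ^ n ≤ suc (n * K) * s × (∀ k N → (4 * 5 ^ k) ^ (n * c) ≤ N → s ^ k ≤ R N)) →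
    ∀ u v .{{_ : NonZero v}} → (5 ^ c) ^ u < b ^ v → ∃ λ N₀ → ∀ N → N₀ ≤ N → N ^ u ≤ R N ^ v
  polynomial-lower-bound R {b} {c} {K} free u v@(suc _) P<Q =
    from (exponential-dominates-linear (v * K) {{m^n≢0 (5 ^ c) u {{m^n≢0 5 c}}}} P<Q)
    where
    open ≤-Reasoning
    from : (∃ λ j → suc (suc j * (v * K)) * ((5 ^ c) ^ u) ^ suc j < (b ^ v) ^ suc j) → ∃ λ N₀ → ∀ N → N₀ ≤ N → N ^ u ≤ R N ^ v
    from (j-1 , lt) with free (suc j-1 * v)
    ... | s , bⁿ≤ , large = g k₀ , λ N g≤N → bound N (between g k<g k₀ N g≤N)
      where
      j n m W C k₀ : ℕ
      j = suc j-1
      -- With n a multiple of v, `W ^ u` is a v-th power, like `(b ^ n) ^ v`, and the two can be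
      -- compared under the exponent v.
      n = j * v
      m = n * c
      W = 5 ^ m
      -- Here 20 = 4 · 5, with 4 from the packing base and 5 from passing from `g k` to `g (suc k)`.
      C = (20 ^ m) ^ u
      k₀ = C * W ^ u
      T : ℕ
      T = suc (n * K)
      g : ℕ → ℕ
      g k = (4 * 5 ^ k) ^ m
      instance
        m≢0 : NonZero m
        m≢0 = m*n≢0 n c
        W≢0 : NonZero (W ^ u)
        W≢0 = m^n≢0 W u {{m^n≢0 5 m}}
      k<5^k : ∀ k → k < 5 ^ k
      k<5^k zero    = s≤s z≤n
      k<5^k (suc k) = begin-strict
        suc k        ≤⟨ k<5^k k ⟩
        5 ^ k        <⟨ m<m*n (5 ^ k) 5 {{m^n≢0 5 k}} (s≤s (s≤s z≤n)) ⟩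
        5 ^ k * 5    ≡⟨ *-comm (5 ^ k) 5 ⟩
        5 * 5 ^ k    ∎
      ≤^ : ∀ x e .{{_ : NonZero x}} .{{_ : NonZero e}} → x ≤ x ^ e
      ≤^ x (suc e) = m≤m*n x (x ^ e) {{m^n≢0 x e}}
      k<g : ∀ k → k < g k
      k<g k = begin-strict
        k            <⟨ k<5^k k ⟩
        5 ^ k        ≤⟨ m≤n*m (5 ^ k) 4 ⟩
        4 * 5 ^ k    ≤⟨ ≤^ (4 * 5 ^ k) m {{m*n≢0 4 (5 ^ k) {{_}} {{m^n≢0 5 k}}}} ⟩
        g k          ∎
      W^u<s^v : W ^ u < s ^ v
      W^u<s^v = *-cancelˡ-< (T ^ v) _ _ (begin-strict
        T ^ v * W ^ u                        ≡⟨ cong (T ^ v *_) W^u≡ ⟩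
        T ^ v * (((5 ^ c) ^ u) ^ j) ^ v      ≡⟨ sym (^-distribʳ-* T (((5 ^ c) ^ u) ^ j) v) ⟩
        (T * ((5 ^ c) ^ u) ^ j) ^ v          ≡⟨ cong (λ x → (suc x * ((5 ^ c) ^ u) ^ j) ^ v) (*-assoc j v K) ⟩
        (suc (j * (v * K)) * ((5 ^ c) ^ u) ^ j) ^ v <⟨ ^-monoˡ-< v lt ⟩
        ((b ^ v) ^ j) ^ v                    ≡⟨ cong (_^ v) (trans (^-*-assoc b v j) (cong (b ^_) (*-comm v j))) ⟩
        (b ^ n) ^ v                          ≤⟨ ^-monoˡ-≤ v bⁿ≤ ⟩
        (T * s) ^ v                          ≡⟨ ^-distribʳ-* T s v ⟩
        T ^ v * s ^ v                        ∎)
        where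
        W^u≡ : W ^ u ≡ (((5 ^ c) ^ u) ^ j) ^ v
        W^u≡ = begin-equality
          (5 ^ (n * c)) ^ u            ≡⟨ cong (λ e → (5 ^ e) ^ u) (*-comm n c) ⟩
          (5 ^ (c * n)) ^ u            ≡⟨ cong (_^ u) (sym (^-*-assoc 5 c n)) ⟩
          ((5 ^ c) ^ n) ^ u            ≡⟨ ^-exchange (5 ^ c) n u ⟩
          ((5 ^ c) ^ u) ^ (j * v)      ≡⟨ sym (^-*-assoc ((5 ^ c) ^ u) j v) ⟩
          (((5 ^ c) ^ u) ^ j) ^ v      ∎
      bound : ∀ N → (∃ λ k → k₀ ≤ k × g k ≤ N × N < g (suc k)) → N ^ u ≤ R N ^ v
      bound N (k , k₀≤k , g≤N , N<g) = begin
        N ^ u                        ≤⟨ ^-monoˡ-≤ u (<⇒≤ N<g) ⟩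
        ((4 * (5 * 5 ^ k)) ^ m) ^ u  ≡⟨ cong (λ x → (x ^ m) ^ u) (sym (*-assoc 4 5 (5 ^ k))) ⟩
        ((20 * 5 ^ k) ^ m) ^ u       ≡⟨ cong (_^ u) (^-distribʳ-* 20 (5 ^ k) m) ⟩
        (20 ^ m * (5 ^ k) ^ m) ^ u   ≡⟨ ^-distribʳ-* (20 ^ m) ((5 ^ k) ^ m) u ⟩
        C * ((5 ^ k) ^ m) ^ u        ≡⟨ cong (λ x → C * x ^ u) (^-exchange 5 k m) ⟩
        C * (W ^ k) ^ u              ≡⟨ cong (C *_) (^-exchange W k u) ⟩
        C * (W ^ u) ^ k              ≤⟨ exponential-dominates-constant C W^u<s^v k k₀≤k ⟩
        (s ^ v) ^ k                  ≡⟨ ^-exchange s v k ⟩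
        (s ^ k) ^ v                  ≤⟨ ^-monoˡ-≤ v (large k N g≤N) ⟩
        R N ^ v                      ∎

-- Passage to real exponents

module Exponents where

  open import Algebra.Bundles using (CommutativeRing)
  open import Data.Integer.Base as ℤ using (-[1+_])
  import Data.Integer.Properties as ℤ
  open import Data.Nat.Base as ℕ using (zero; suc)
  import Data.Nat.Properties as ℕ
  open import Data.Rational.Base hiding (NonZero; _/_; _≥_)
  open import Data.Rational.Properties
  import Data.Rational.Unnormalised.Base as ℚᵘ
  import Data.Rational.Unnormalised.Properties as ℚᵘ
  open import Data.Unit.Base using (tt)
  open import Algebra.Properties.CommutativeSemiring.Exp (CommutativeRing.commutativeSemiring +-*-commutativeRing) using (_^_; ^-assocʳ)
  open ℚ-Lemmas
  open Power-Lemmas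
  open ℝ
  open ℝ-Lemmas

  fromℕ-* : ∀ m n → fromℕ m * fromℕ n ≡ fromℕ (m ℕ.* n)
  fromℕ-* m n = trans (cong (λ z → z / 1) (sym (ℤ.pos-* m n))) (↥p/↧p≡p (fromℕ (m ℕ.* n)))

  fromℕ-^ : ∀ m n → fromℕ m ^ n ≡ fromℕ (m ℕ.^ n)
  fromℕ-^ m zero    = refl
  fromℕ-^ m (suc n) = trans (cong (fromℕ m *_) (fromℕ-^ m n)) (fromℕ-* m (m ℕ.^ n))

  fromℕ-mono-< : ∀ {m n} → m ℕ.< n → fromℕ m < fromℕ n
  fromℕ-mono-< {m} {n} m<n = *<* (subst₂ ℤ._<_ (sym (ℤ.*-identityʳ (+ m))) (sym (ℤ.*-identityʳ (+ n))) (ℤ.+<+ m<n))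

  fromℕ-mono-≤ : ∀ {m n} → m ℕ.≤ n → fromℕ m ≤ fromℕ n
  fromℕ-mono-≤ {m} {n} m≤n = *≤* (subst₂ ℤ._≤_ (sym (ℤ.*-identityʳ (+ m))) (sym (ℤ.*-identityʳ (+ n))) (ℤ.+≤+ m≤n))

  fromℕ-cancel-< : ∀ {m n} → fromℕ m < fromℕ n → m ℕ.< n
  fromℕ-cancel-< {m} {n} (*<* lt) = ℤ.drop‿+<+ (subst₂ ℤ._<_ (ℤ.*-identityʳ (+ m)) (ℤ.*-identityʳ (+ n)) lt)

  -- With a = u/v, the quotient cut yields rationals a₁ < log₂ 15 and c > log₂ 5 such that 3ac < a₁.
  -- Then 5^(3u) < 2^(3uc) < 2^(v a₁) < 15^v, where fractional exponents are cleared by raising to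
  -- powers.
  α-lower : ∀ a {u} → ↥ a ≡ + u → lower α a → (5 ℕ.^ 3) ℕ.^ u ℕ.< 15 ℕ.^ ↧ₙ a
  α-lower a@(mkℚ (+ u) v-1 _) refl (a₁@(mkℚ _ _ _) , b₁ , la₁ , ub₁ , ab₁<a₁) = fromℕ-cancel-<
    (subst₂ _<_ (trans (fromℕ-^ 5 (3 ℕ.* u)) (cong fromℕ (sym (ℕ.^-*-assoc 5 3 u)))) (fromℕ-^ 15 v)
      (from (b₁ * inv (positive⁻¹ (fromℕ 3))) (*-inv-cancel (positive⁻¹ (fromℕ 3)) b₁) ub₁))
    where
    open ≤-Reasoning
    v : ℕ
    v = suc v-1
    -- The value b₁/3 is generalised to a variable c, so that it can be matched as numerator over
    -- denominator.
    from : ∀ c → c * fromℕ 3 ≡ b₁ → <pow (fromℕ 5) 2 c → fromℕ 5 ^ (3 ℕ.* u) < fromℕ 15 ^ v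
    from c@(mkℚ C c-1 _) c3≡b₁ 5<2ᶜ = ^-cancel-< C₂ (^-nonNeg v (0≤fromℕ 15)) (begin-strict
      (fromℕ 5 ^ (3 ℕ.* u)) ^ C₂       ≡⟨ ^-swap (fromℕ 5) (3 ℕ.* u) C₂ ⟩
      (fromℕ 5 ^ C₂) ^ (3 ℕ.* u)       ≤⟨ ^-mono-≤ (3 ℕ.* u) (^-nonNeg C₂ (0≤fromℕ 5)) (<⇒≤ 5<2ᶜ) ⟩
      (2 ^ᶻ C) ^ (3 ℕ.* u)             ≡⟨ sym (^ᶻ-* 2 C (3 ℕ.* u)) ⟩
      2 ^ᶻ (C ℤ.* + (3 ℕ.* u))         <⟨ raise-down 2 (0≤fromℕ 15) (↥ a₁) (↧ₙ a₁) (C ℤ.* + (3 ℕ.* u)) (v ℕ.* C₂) (ℤ.<⇒≤ cross) la₁ ⟩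
      fromℕ 15 ^ (v ℕ.* C₂)            ≡⟨ sym (^-assocʳ (fromℕ 15) v C₂) ⟩
      (fromℕ 15 ^ v) ^ C₂              ∎)
      where
      C₂ : ℕ
      C₂ = suc c-1
      -- Unnormalised products have explicit numerators and denominators, so the inequality unfolds
      -- to integer cross multiplication.
      unnormalised : toℚᵘ a ℚᵘ.* (toℚᵘ c ℚᵘ.* toℚᵘ (fromℕ 3)) ℚᵘ.< toℚᵘ a₁
      unnormalised = ℚᵘ.<-respˡ-≃ (ℚᵘ.≃-trans (toℚᵘ-homo-* a (c * fromℕ 3)) (ℚᵘ.*-congˡ {toℚᵘ a} (toℚᵘ-homo-* c (fromℕ 3))))
        (toℚᵘ-mono-< (subst (λ b → a * b < a₁) (sym c3≡b₁) ab₁<a₁))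
      numerator : (+ u) ℤ.* (C ℤ.* + 3) ≡ C ℤ.* + (3 ℕ.* u)
      numerator = trans (ℤ.*-comm (+ u) (C ℤ.* + 3)) (trans (ℤ.*-assoc C (+ 3) (+ u)) (cong (C ℤ.*_) (sym (ℤ.pos-* 3 u))))
      cross : (C ℤ.* + (3 ℕ.* u)) ℤ.* ↧ a₁ ℤ.< ↥ a₁ ℤ.* + (v ℕ.* C₂)
      cross = subst₂ ℤ._<_ (cong (ℤ._* ↧ a₁) numerator) (cong (λ d → ↥ a₁ ℤ.* + (v ℕ.* d)) (ℕ.*-identityʳ C₂)) (drop unnormalised)
        where
        drop : toℚᵘ a ℚᵘ.* (toℚᵘ c ℚᵘ.* toℚᵘ (fromℕ 3)) ℚᵘ.< toℚᵘ a₁ →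
               ((+ u) ℤ.* (C ℤ.* + 3)) ℤ.* ↧ a₁ ℤ.< ↥ a₁ ℤ.* + (v ℕ.* (C₂ ℕ.* 1))
        drop (ℚᵘ.*<* lt) = lt

  -- The approximations 15819 / 4049 < log₂ 15 and log₂ 5 < 10790 / 4647 come from continued fractions;
  -- 3 · 10790 / 4647 = 10790 / 1549.
  α-numeric : fromℚ (+ 5608687 / 10000000) <ℝ α
  α-numeric = lower-open α {+ 5608687 / 10000000}
    (+ 15819 / 4049 , + 10790 / 1549 , log15 , log5 , from-yes (+ 5608687 / 10000000 * (+ 10790 / 1549) <? + 15819 / 4049))
    where
    log15 : fromℕ 2 ^ 15819 < fromℕ 15 ^ 4049
    log15 = subst₂ _<_ (sym (fromℕ-^ 2 15819)) (sym (fromℕ-^ 15 4049)) (fromℕ-mono-< (ℕ.<ᵇ⇒< (2 ℕ.^ 15819) (15 ℕ.^ 4049) tt))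
    log5 : fromℕ 5 ^ 4647 < fromℕ 2 ^ 10790
    log5 = subst₂ _<_ (sym (fromℕ-^ 5 4647)) (sym (fromℕ-^ 2 10790)) (fromℕ-mono-< (ℕ.<ᵇ⇒< (5 ℕ.^ 4647) (2 ℕ.^ 10790) tt))

  -- The approximation a of α from below within δ absorbs every exponent t < α - δ.
  power-bound : (R : ℕ → ℕ) → (∀ N .{{_ : NonZero N}} → 1 ℕ.≤ R N) →
    (∀ u v .{{_ : NonZero v}} → (5 ℕ.^ 3) ℕ.^ u ℕ.< 15 ℕ.^ v → ∃ λ N₀ → ∀ N → N₀ ℕ.≤ N → N ℕ.^ u ℕ.≤ R N ℕ.^ v) →
    ∀ δ → 0ℝ <ℝ δ → ∃ λ N₀ → ∀ N .{{_ : NonZero N}} → N₀ ℕ.≤ N → N ^ℝ (α -ℝ δ) ≤ℝ fromℚ (fromℕ (R N))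
  power-bound R 1≤R bound δ (ε , 0<ε , lε) = from (approximate α 0<ε)
    where
    Goal : Set
    Goal = ∃ λ N₀ → ∀ N .{{_ : NonZero N}} → N₀ ℕ.≤ N → N ^ℝ (α -ℝ δ) ≤ℝ fromℚ (fromℕ (R N))

    below : ∀ {a t} → upper α (a + ε) → lower (α -ℝ δ) t → t < a
    below {a} {t} u (a′ , b′ , la′ , ub′ , t<) = begin-strict
      t            <⟨ t< ⟩
      a′ - b′      <⟨ +-mono-< {a′} {a + ε} (separated α {a′} {a + ε} la′ u) (neg-antimono-< (separated δ lε ub′)) ⟩
      a + ε - ε    ≡⟨ trans (+-assoc a ε (- ε)) (trans (cong (λ z → a + z) (+-inverseʳ ε)) (+-identityʳ a)) ⟩
      a            ∎
      where open ≤-Reasoning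

    reduce : ∀ a → upper α (a + ε) → ∀ N .{{_ : NonZero N}} → N ^ᶻ ↥ a ≤ fromℕ (R N) ^ ↧ₙ a →
             N ^ℝ (α -ℝ δ) ≤ℝ fromℚ (fromℕ (R N))
    -- The lower cut of a power contains every q ≤ 0 by definition; these lie below `R N` because
    -- `R N` is at least 1.
    reduce a ua N le q (inj₁ q≤0) = ≤-<-trans q≤0 (<-≤-trans 0<1 (fromℕ-mono-≤ (1≤R N)))
    reduce a ua N le q (inj₂ (t , lt , q<)) with 0ℚ ≤? q
    ... | yes 0≤q = ^-cancel-< (↧ₙ a) (0≤fromℕ (R N)) (<-≤-trans (<pow-≤ N 0≤q {t} {a} (<⇒≤ (below {a} {t} ua lt)) q<) le)
    -- For negative q the comparison of powers carries no information, as `↧ₙ t` may be even.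
    ... | no  0≰q = <-≤-trans (≰⇒> 0≰q) (0≤fromℕ (R N))

    from : (∃ λ a → lower α a × upper α (a + ε)) → Goal
    from (a@(mkℚ (+ u) v-1 _) , la , ua) =
      let N₀ , le = bound u (suc v-1) (α-lower a refl la)
      in N₀ , λ N N₀≤N → reduce a ua N (subst₂ _≤_ (sym (fromℕ-^ N u)) (sym (fromℕ-^ (R N) (suc v-1))) (fromℕ-mono-≤ (le N N₀≤N)))
    -- For large ε the approximation of α may be negative. Then N to this power is at most 1, hence
    -- at most `R N`, for every N.
    from (a@(mkℚ -[1+ n ] v-1 _) , la , ua) = 0 , λ N _ → reduce a ua N (begin
      N ^ᶻ -[1+ n ]          ≤⟨ ^ᶻ-mono-≤ N { -[1+ n ]} {+ 0} ℤ.-≤+ ⟩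
      1ℚ                     ≤⟨ 1≤^ (suc v-1) (fromℕ-mono-≤ (1≤R N)) ⟩
      fromℕ (R N) ^ suc v-1  ∎)
      where open ≤-Reasoning

theorem1 : (fromℚ (+ 5608687 / 10000000) <ℝ α) ×
    (∀ (δ : ℝ) → 0ℝ <ℝ δ →
    ∃[ N₀ ] ∀ (N : ℕ) .{{_ : NonZero N}} → N ≥ N₀ →
    N ^ℝ (α -ℝ δ) ≤ℝ fromℚ (fromℕ (r L₃ N)))
theorem1 = α-numeric , power-bound (r L₃) r≥1 (polynomial-lower-bound (r L₃) free-sets)
  where
  open Counting
  open Exponents
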